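{- Let $G=(V,E)$ be a finite undirected, unweighted graph with $n=|V|$ vertices and $m=|E|$ edges, and let $w$ be the tree-width of $G$. There is an order $v_1,\ldots,v_n$ of the vertices of $G$ with which the pruned landmark labeling method takes $O(wm\log n+w^2n\log^2 n)$ time for preprocessing, stores an index with $O(wn\log n)$ space, and answers each distance query in $O(w\log n)$ time.
   Context: Tree-width is the usual notion of Robertson and Seymour. $N_G(u)$ is the set of neighbors of $u$. An index $L$ assigns to each vertex $v$ a label $L(v)$, a finite set of pairs $(u,\delta_{uv})$ with $u\in V$ and $\delta_{uv}$ a distance value. For an index $L$, $$\mathrm{Query}(s,t,L)=\min\{\delta_{vs}+\delta_{vt}\mid (v,\delta_{vs})\in L(s),\ (v,\delta_{vt})\in L(t)\},$$ with value $\infty$ if $L(s)$ and $L(t)$ share no vertex. Pruned landmark labeling with respect to an order $v_1,\ldots,v_n$ of $V$ (preprocessing): $L'_0(u)=\emptyset$ for all $u\in V$. For $k=1,\ldots,n$, $L'_k$ is obtained from $L'_{k-1}$ by a pruned breadth-first search (BFS) from $v_k$: set $P[v_k]=0$ and $P[v]=\infty$ for all $v\neq v_k$, and start with a FIFO queue containing only $v_k$. While the queue is nonempty, dequeue a vertex $u$. If $\mathrm{Query}(v_k,u,L'_{k-1})\le P[u]$, then $u$ is pruned: nothing is added to its label and no edge from $u$ is traversed. Otherwise set $L'_k(u)=L'_{k-1}(u)\cup\{(v_k,P[u])\}$, and for every $w'\in N_G(u)$ with $P[w']=\infty$ set $P[w']=P[u]+1$ and enqueue $w'$. For every vertex $u$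 that is pruned or not visited, $L'_k(u)=L'_{k-1}(u)$. The final index is $L'_n$, and a distance query $(s,t)$ is answered by computing $\mathrm{Query}(s,t,L'_n)$. Cost conventions: the graph is given by adjacency lists and the order is given; a single index is kept and updated in place (no copying of $L'_{k-1}$). The array $P$ is initialized to $\infty$ once, and after each pruned BFS only the entries of visited vertices are reset, so there is no $O(n)$ initialization per BFS. Before the $k$-th BFS, an array $T$ (also initialized to $\infty$ once and reset only where modified) is filled with $T[x]=\delta_{xv_k}$ for $(x,\delta_{xv_k})\in L'_{k-1}(v_k)$, so that each pruning test $\mathrm{Query}(v_k,u,L'_{k-1})$ takes $O(|L'_{k-1}(u)|)$ time. Labels are kept sorted by the rank of the vertex in the order (which is automatic, since pairs are appended in order of increasing rank), so $\mathrm{Query}(s,t,L'_n)$ is computed by a merge in $O(|L'_n(s)|+|L'_n(t)|)$ time. Index space is measured by the total number of pairs stored, $\sum_{v\in V}|L'_n(v)|$.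
   Formalization: In the bounds, w and log n are read as max(1,w) and max(1,⌊log₂ n⌋): for an edgeless graph (w = 0, including n = 1) the literal bounds are 0, although every vertex stores a pair and every query takes at least one step. -}

module Defs where

open import Algebra.Construct.Add.Identity using (liftOp)
open import Data.Bool using (if_then_else_)
open import Data.Fin using (Fin; zero; suc; _<?_; _≟_)
open import Data.Fin.Permutation using (Permutation′; _⟨$⟩ʳ_; _⟨$⟩ˡ_)
open import Data.Fin.Subset using (Subset; ∣_∣) renaming (_∈_ to _∈ˢ_)
open import Data.List
  using (List; []; _∷_; _∷ʳ_; allFin; concatMap; filter; foldl; foldr; length; map)
open import Data.List.Extrema.Nat using (max)
open import Data.List.Membership.Propositional using (_∈_; _∉_)
open import Data.List.Properties using (length-++)
open import Data.List.Relation.Unary.All using (All)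
open import Data.List.Relation.Unary.Unique.Propositional using (Unique)
open import Data.Nat using (ℕ; zero; suc; _+_; _*_; _∸_; _⊓_; _≤_; _≤?_; s≤s; NonZero)
open import Data.Nat.GeneralisedArithmetic using (iterate)
open import Data.Nat.ListAction using (sum)
open import Data.Nat.Properties
  using (+-suc; +-comm; ≤-reflexive; ≤-trans; n≤0⇒n≡0)
open import Data.Product using (Σ; ∃; _×_; _,_; proj₁; proj₂; map₂) renaming (map to map×)
open import Data.Vec.Functional using (Vector; updateAt)
open import Function using (const; _∘_)
open import Relation.Binary.Construct.Add.Supremum.NonStrict _≤_ using (_≤⁺_; ≤⁺-dec)
open import Relation.Binary.Construct.Closure.ReflexiveTransitive using (Star; ε; _◅_)
open import Relation.Binary.PropositionalEquality
  using (_≡_; refl; sym; trans; cong; subst; module ≡-Reasoning)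
open import Relation.Nullary using (¬_; Dec; does; yes; no)
open import Relation.Nullary.Construct.Add.Supremum using (_⁺; [_]; ⊤⁺)

-- Finite simple graphs on the vertex set Fin n, given by adjacency lists.
record Graph (n : ℕ) : Set where
  field
    N        : Fin n → List (Fin n)
    N-unique : ∀ u → Unique (N u)
    N-sym    : ∀ {u v} → v ∈ N u → u ∈ N v
    N-irrefl : ∀ u → u ∉ N u

open Graph public

module _ {n : ℕ} (G : Graph n) where

  -- Each undirected edge is listed once, with its smaller endpoint first.
  edges : List (Fin n × Fin n)
  edges = concatMap (λ u → map (u ,_) (filter (u <?_) (N G u))) (allFin n)

  ∣E∣ : ℕ
  ∣E∣ = length edges

  Adj : Fin n → Fin n → Set
  Adj u v = v ∈ N G u

  Walk : Fin n → Fin n → Set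
  Walk = Star Adj

  vertices : ∀ {u v} → Walk u v → List (Fin n)
  vertices {u} ε       = u ∷ []
  vertices {u} (_ ◅ p) = u ∷ vertices p

  Connected : Set
  Connected = ∀ u v → Walk u v

  -- A cycle is a path on at least three distinct vertices whose ends are adjacent.
  Acyclic : Set
  Acyclic = ∀ {u v} (p : Walk u v) → Unique (vertices p) → 3 ≤ length (vertices p) → ¬ Adj v u

  record IsTree : Set where
    field
      nonempty  : NonZero n
      connected : Connected
      acyclic   : Acyclic

record TreeDecomposition {n : ℕ} (G : Graph n) : Set where
  field
    nodes    : ℕ
    tree     : Graph nodes
    isTree   : IsTree tree
    bag      : Fin nodes → Subset n
    covers-V : ∀ v → ∃ λ t → v ∈ˢ bag t
    covers-E : ∀ {u v} → Adj G u v → ∃ λ t → u ∈ˢ bag t × v ∈ˢ bag t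
    -- The nodes whose bags contain v induce a connected subgraph of the tree.
    subtree  : ∀ v {t t′} → v ∈ˢ bag t → v ∈ˢ bag t′ →
               Σ (Walk tree t t′) λ p → All (λ s → v ∈ˢ bag s) (vertices tree p)

  -- Truncated subtraction only matters for the graph without vertices,
  -- which thereby gets width 0 instead of -1.
  width : ℕ
  width = max 0 (map (∣_∣ ∘ bag) (allFin nodes)) ∸ 1

open TreeDecomposition public using (width)

IsTreeWidth : ∀ {n} → Graph n → ℕ → Set
IsTreeWidth G w = (∃ λ (D : TreeDecomposition G) → width D ≡ w)
                × (∀ (D : TreeDecomposition G) → w ≤ width D)

ℕ∞ : Set
ℕ∞ = ℕ ⁺

pattern ∞ = ⊤⁺

_≤∞?_ : (a b : ℕ∞) → Dec (a ≤⁺ b)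
_≤∞?_ = ≤⁺-dec _≤?_

_⊓∞_ : ℕ∞ → ℕ∞ → ℕ∞
_⊓∞_ = liftOp _⊓_

-- A label lists its pairs in the order in which they were appended.
Label : ℕ → Set
Label n = List (Fin n × ℕ)

Index : ℕ → Set
Index n = Vector (Label n) n

module _ {n : ℕ} where

  commonHubSums : Label n → Label n → List ℕ
  commonHubSums ls lt =
    concatMap (λ (v , δ) → map (λ (_ , δ′) → δ + δ′) (filter (λ (v′ , _) → v ≟ v′) lt)) ls

  query : Fin n → Fin n → Index n → ℕ∞
  query s t L = foldr (λ δ q → [ δ ] ⊓∞ q) ∞ (commonHubSums (L s) (L t))

  indexSize : Index n → ℕ
  indexSize L = sum (map (length ∘ L) (allFin n))

-- `time` counts elementary operations: unit cost for each array access, queue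
-- operation, list cell read or label entry appended, up to constant factors.
record State (n : ℕ) : Set where
  constructor state
  field
    index : Index n
    P     : Vector ℕ∞ n
    queue : List (Fin n)
    time  : ℕ

open State public

module PrunedBFS {n : ℕ} (G : Graph n) (L : Index n) (r : Fin n) where
  -- Here L is the index before the search and r is the root v_k.

  -- One operation for reading w; on a first visit, three more, for writing
  -- P[w], enqueueing w, and resetting P[w] after the search.
  visit : ℕ → State n → Fin n → State n
  visit d (state I P Q τ) w with P w
  ... | ∞     = state I (updateAt P w (const [ suc d ])) (Q ∷ʳ w) (4 + τ)
  ... | [ _ ] = state I P Q (1 + τ)

  -- The pruning test reads the label of u against the array T. (Queued vertices
  -- have a finite P-value; for P[u] = ∞ the inequality Query ≤ P[u] would hold.)
  process : Fin n → State n → State n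
  process u (state I P Q τ) with P u
  ... | ∞     = state I P Q τ
  ... | [ d ] with query r u L ≤∞? [ d ]
  ...   | yes _ = state I P Q (1 + length (L u) + τ)
  ...   | no  _ = foldl (visit d)
                    (state (updateAt I u (_∷ʳ (r , d))) P Q (2 + length (L u) + τ))
                    (N G u)

  -- The identity on states with empty queue.
  step : State n → State n
  step (state I P []      τ) = state I P [] τ
  step (state I P (u ∷ Q) τ) = process u (state I P Q (1 + τ))

  -- The cost consists of filling and later resetting T, writing and later
  -- resetting P[r], and enqueueing r.
  start : State n
  start = state L (updateAt (const ∞) r (const [ 0 ])) (r ∷ []) (3 + 2 * length (L r))

  -- No vertex is enqueued twice, so n rounds run the loop to completion;
  -- see queue-exhausted.
  final : State n
  final = iterate step start n

  isUnvisited : ℕ∞ → ℕ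
  isUnvisited ∞     = 1
  isUnvisited [ _ ] = 0

  unvisited : ∀ {m} → Vector ℕ∞ m → ℕ
  unvisited {zero}  P = 0
  unvisited {suc m} P = isUnvisited (P zero) + unvisited (P ∘ suc)

  unvisited-update : ∀ {m} (P : Vector ℕ∞ m) w {d} → P w ≡ ∞ →
                     suc (unvisited (updateAt P w (const [ d ]))) ≡ unvisited P
  unvisited-update P zero    eq rewrite eq = refl
  unvisited-update P (suc w) eq =
    trans (sym (+-suc (isUnvisited (P zero)) _))
          (cong (isUnvisited (P zero) +_) (unvisited-update (P ∘ suc) w eq))

  unvisited-∞ : ∀ m → unvisited {m} (const ∞) ≡ m
  unvisited-∞ zero    = refl
  unvisited-∞ (suc m) = cong suc (unvisited-∞ m)

  potential : State n → ℕ
  potential s = unvisited (P s) + length (queue s)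

  length-∷ʳ : ∀ (Q : List (Fin n)) w → length (Q ∷ʳ w) ≡ suc (length Q)
  length-∷ʳ Q w = trans (length-++ Q) (+-comm (length Q) 1)

  visit-potential : ∀ d s w → potential (visit d s w) ≡ potential s
  visit-potential d (state I P Q τ) w with P w in eq
  ... | [ _ ] = refl
  ... | ∞     = begin
    unvisited P′ + length (Q ∷ʳ w)  ≡⟨ cong (unvisited P′ +_) (length-∷ʳ Q w) ⟩
    unvisited P′ + suc (length Q)   ≡⟨ +-suc (unvisited P′) (length Q) ⟩
    suc (unvisited P′) + length Q   ≡⟨ cong (_+ length Q) (unvisited-update P w eq) ⟩
    unvisited P + length Q          ∎
    where
    open ≡-Reasoning
    P′ : Vector ℕ∞ n
    P′ = updateAt P w (const [ suc d ])

  visits-potential : ∀ d s ws → potential (foldl (visit d) s ws) ≡ potential s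
  visits-potential d s []       = refl
  visits-potential d s (w ∷ ws) =
    trans (visits-potential d (visit d s w) ws) (visit-potential d s w)

  process-potential : ∀ u s → potential (process u s) ≡ potential s
  process-potential u (state I P Q τ) with P u
  ... | ∞     = refl
  ... | [ d ] with query r u L ≤∞? [ d ]
  ...   | yes _ = refl
  ...   | no  _ = visits-potential d _ (N G u)

  iterate-empty : ∀ f I P τ → queue (iterate step (state I P [] τ) f) ≡ []
  iterate-empty zero    I P τ = refl
  iterate-empty (suc f) I P τ = iterate-empty f I P τ

  drained : ∀ f s → potential s ≤ f → queue (iterate step s f) ≡ []
  drained f (state I P [] τ) _ = iterate-empty f I P τ
  drained zero (state I P (u ∷ Q) τ) h
    with () ← trans (sym (+-suc (unvisited P) (length Q))) (n≤0⇒n≡0 h)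
  drained (suc f) (state I P (u ∷ Q) τ) h
    with subst (_≤ suc f) (+-suc (unvisited P) (length Q)) h
  ... | s≤s h′ = drained f (process u (state I P Q (1 + τ)))
                   (≤-trans (≤-reflexive (process-potential u (state I P Q (1 + τ)))) h′)

  start-potential : potential start ≡ n
  start-potential = begin
    unvisited P₀ + 1     ≡⟨ +-comm (unvisited P₀) 1 ⟩
    suc (unvisited P₀)   ≡⟨ unvisited-update (const ∞) r refl ⟩
    unvisited {n} (const ∞) ≡⟨ unvisited-∞ n ⟩
    n                    ∎
    where
    open ≡-Reasoning
    P₀ : Vector ℕ∞ n
    P₀ = updateAt (const ∞) r (const [ 0 ])

  queue-exhausted : queue final ≡ []
  queue-exhausted = drained n start (≤-reflexive start-potential)

-- A vertex order is a permutation σ, with v_k = σ ⟨$⟩ʳ k and rank σ ⟨$⟩ˡ v.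
module _ {n : ℕ} where

  -- The second components count operations; the initial 3 * n is for setting up
  -- the arrays L, P and T.
  search : Graph n → Permutation′ n → Index n × ℕ → Fin n → Index n × ℕ
  search G σ (L , τ) k = index s , time s + τ
    where
    s : State n
    s = PrunedBFS.final G L (σ ⟨$⟩ʳ k)

  preprocess : Graph n → Permutation′ n → Index n × ℕ
  preprocess G σ = foldl (search G σ) (const [] , 3 * n) (allFin n)

  pllIndex : Graph n → Permutation′ n → Index n
  pllIndex G σ = proj₁ (preprocess G σ)

  preprocessTime : Graph n → Permutation′ n → ℕ
  preprocessTime G σ = proj₂ (preprocess G σ)

  -- Merging two labels sorted by rank, with the number of operations.
  merge : Permutation′ n → Label n → Label n → ℕ∞ × ℕ
  merge σ []             _              = ∞ , 1
  merge σ (_ ∷ _)        []             = ∞ , 1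
  merge σ ((u , d) ∷ ls) ((v , e) ∷ lt) =
    if      does (σ ⟨$⟩ˡ u <? σ ⟨$⟩ˡ v) then map₂ suc (merge σ ls ((v , e) ∷ lt))
    else if does (σ ⟨$⟩ˡ v <? σ ⟨$⟩ˡ u) then map₂ suc (merge σ ((u , d) ∷ ls) lt)
    else                                     map× ([ d + e ] ⊓∞_) suc (merge σ ls lt)

  answer : Permutation′ n → Index n → Fin n → Fin n → ℕ∞
  answer σ L s t = proj₁ (merge σ (L s) (L t))

  answerTime : Permutation′ n → Index n → Fin n → Fin n → ℕ
  answerTime σ L s t = proj₂ (merge σ (L s) (L t))

module Submission where

-- Call a colouring κ of the vertices centred if the least colour on a walk cannot occur at two
-- different vertices of it, and process the vertices by increasing colour. An earlier vertex shares a
-- sufficiently short hub with the root r, so the search from r is pruned at every vertex of smaller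
-- colour and expands u only along a route of colours ≥ κ r. Two roots of equal colour cannot both
-- reach u like this, hence each label has at most D entries if there are D colours, and each vertex
-- is visited by at most D searches from roots of no larger colour; by the same argument, one search
-- visits at most D vertices of smaller colour than its root.
--
-- D = O(w log n) colours suffice. The nodes of the tree of an optimal decomposition get levels
-- ≤ 1 + log n such that between two nodes of equal level there is one of a larger level. This is
-- done bottom-up: the set of levels that show above a subtree is read as a binary numeral, and the
-- level of a node is chosen so that this numeral does not exceed the number of vertices of G that
-- are assigned to nodes of the subtree. A vertex is coloured by the largest level among its bags
-- together with its position in the bag where this level is attained.

open import Defs
open import Data.Bool using (true; false)
open import Data.Empty using (⊥; ⊥-elim)
open import Data.Fin as Fin using (Fin; zero; suc; toℕ; fromℕ<; punchIn; _≟_; _<?_)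
open import Data.Fin.Permutation as Perm
  using (Permutation′; _⟨$⟩ʳ_; _⟨$⟩ˡ_; insert; insert-punchIn; inverseʳ; inverseˡ)
import Data.Fin.Properties as Fin
open import Data.Fin.Subset using (Subset; ∣_∣; inside; outside) renaming (_∈_ to _∈ˢ_)
open import Data.Fin.Subset.Properties using () renaming (_∈?_ to _∈ˢ?_)
open import Data.List
  using (List; []; _∷_; _++_; _∷ʳ_; allFin; concatMap; filter; foldl; foldr; length; map)
open import Data.List.Extrema.Nat
  using (argmax; argmax-all; f[xs]≤f[argmax]; argmin; f[argmin]≤f[xs]; xs≤max)
import Data.List.Membership.DecPropositional as DecMembership
open import Data.List.Membership.Propositional using (_∈_; _∉_; find; lose)
open import Data.List.Membership.Propositional.Properties
open import Data.List.Properties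
  using (map-++; length-map; length-tabulate; length-++; ++-assoc; ++-identityʳ;
         filter-none; filter-accept; filter-reject; filter-notAll)
open import Data.List.Relation.Unary.All as All using (All; []; _∷_)
import Data.List.Relation.Unary.All.Properties as All
open import Data.List.Relation.Unary.AllPairs as AllPairs using (AllPairs; []; _∷_)
import Data.List.Relation.Unary.AllPairs.Properties as AllPairs
open import Data.List.Relation.Unary.Any as Any using (here; there)
open import Data.List.Relation.Unary.Unique.Propositional using (Unique)
import Data.List.Relation.Unary.Unique.Propositional.Properties as Unique
open import Data.Nat hiding (_≟_; _<?_)
open import Data.Nat.GeneralisedArithmetic using (iterate)
open import Data.Nat.ListAction using (sum)
open import Data.Nat.ListAction.Properties using (sum-++)
open import Data.Nat.Logarithm using (⌊log₂_⌋; ⌊log₂⌋-mono-≤; ⌊log₂[2^n]⌋≡n)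
open import Data.Nat.Properties hiding (_≟_; _<?_)
open import Data.Nat.Tactic.RingSolver using (solve-∀)
open import Data.Product using (Σ; ∃; _×_; _,_; proj₁; proj₂; swap)
open import Data.Product.Properties using (,-injectiveʳ)
open import Data.Sum using (_⊎_; inj₁; inj₂)
open import Data.Unit using (⊤; tt)
open import Data.Vec using (_∷_; here; there)
open import Data.Vec.Functional using (updateAt)
open import Data.Vec.Functional.Properties using (updateAt-updates; updateAt-minimal)
open import Algebra.Properties.CommutativeSemigroup +-commutativeSemigroup using (x∙yz≈y∙xz; interchange)
open import Function using (_∘_; const; id)
open import Relation.Binary.Construct.Add.Supremum.NonStrict _≤_ using (_≤⁺_; [_]; ≤⁺-trans)
open import Relation.Binary.Construct.Closure.ReflexiveTransitive as Star using (Star; ε; _◅_; _◅◅_)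
open import Relation.Binary.Definitions using (tri<; tri≈; tri>)
open import Relation.Binary.PropositionalEquality
open import Relation.Nullary
  using (¬_; Dec; yes; no; contradiction; ofʸ; ofⁿ; ¬?; _×-dec_; decidable-stable)
open import Relation.Nullary.Construct.Add.Supremum using ([_])
open import Relation.Unary using (Decidable)


-- Counting

total : ∀ {A : Set} → (A → ℕ) → List A → ℕ
total f xs = sum (map f xs)

module _ {A : Set} where

  total-++ : ∀ (f : A → ℕ) xs ys → total f (xs ++ ys) ≡ total f xs + total f ys
  total-++ f xs ys = trans (cong sum (map-++ f xs ys)) (sum-++ (map f xs) (map f ys))

  total-+ : ∀ (f g : A → ℕ) xs → total (λ x → f x + g x) xs ≡ total f xs + total g xs
  total-+ f g []       = refl
  total-+ f g (x ∷ xs) = begin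
    f x + g x + total _ xs                  ≡⟨ cong (f x + g x +_) (total-+ f g xs) ⟩
    f x + g x + (total f xs + total g xs)   ≡⟨ +-assoc (f x) (g x) _ ⟩
    f x + (g x + (total f xs + total g xs)) ≡⟨ cong (f x +_) (x∙yz≈y∙xz (g x) (total f xs) _) ⟩
    f x + (total f xs + (g x + total g xs)) ≡⟨ sym (+-assoc (f x) _ _) ⟩
    f x + total f xs + (g x + total g xs)   ∎
    where
    open ≡-Reasoning

  total-mono : ∀ (f g : A → ℕ) xs → (∀ {x} → x ∈ xs → f x ≤ g x) → total f xs ≤ total g xs
  total-mono f g []       h = z≤n
  total-mono f g (x ∷ xs) h = +-mono-≤ (h (here refl)) (total-mono f g xs (h ∘ there))

  total-const : ∀ c (xs : List A) → total (const c) xs ≡ length xs * c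
  total-const c []       = refl
  total-const c (x ∷ xs) = cong (c +_) (total-const c xs)

  total-≤const : ∀ (f : A → ℕ) c xs → (∀ {x} → x ∈ xs → f x ≤ c) → total f xs ≤ length xs * c
  total-≤const f c xs h = subst (total f xs ≤_) (total-const c xs) (total-mono f (const c) xs h)

  total-length : ∀ (xs : List A) → total (const 1) xs ≡ length xs
  total-length xs = trans (total-const 1 xs) (*-identityʳ (length xs))

  total-⊆ : ∀ (f : A → ℕ) {xs ys} → Unique xs → (∀ {x} → x ∈ xs → x ∈ ys) → total f xs ≤ total f ys
  total-⊆ f {[]}     u h = z≤n
  total-⊆ f {x ∷ xs} (x∉ ∷ u) h with ∈-∃++ (h (here refl))
  ... | as , bs , refl = begin
    f x + total f xs               ≤⟨ +-monoʳ-≤ (f x) (total-⊆ f u sub) ⟩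
    f x + total f (as ++ bs)       ≡⟨ cong (f x +_) (total-++ f as bs) ⟩
    f x + (total f as + total f bs) ≡⟨ x∙yz≈y∙xz (f x) (total f as) _ ⟩
    total f as + (f x + total f bs) ≡⟨ sym (total-++ f as (x ∷ bs)) ⟩
    total f (as ++ x ∷ bs)         ∎
    where
    open ≤-Reasoning
    sub : ∀ {y} → y ∈ xs → y ∈ as ++ bs
    sub y∈ with ∈-++⁻ as (h (there y∈))
    ... | inj₁ p          = ∈-++⁺ˡ p
    ... | inj₂ (here refl) = contradiction refl (All.lookup x∉ y∈)
    ... | inj₂ (there p)  = ∈-++⁺ʳ as p

  length-⊆ : ∀ {xs ys : List A} → Unique xs → (∀ {x} → x ∈ xs → x ∈ ys) → length xs ≤ length ys
  length-⊆ {xs} {ys} u h = subst₂ _≤_ (total-length xs) (total-length ys) (total-⊆ (const 1) u h)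

module _ {A : Set} where

  Unique-map : ∀ {B : Set} (f : A → B) {xs} → Unique xs →
               (∀ {x y} → x ∈ xs → y ∈ xs → f x ≡ f y → x ≡ y) → Unique (map f xs)
  Unique-map f {[]}     []       inj = []
  Unique-map f {x ∷ xs} (x∉ ∷ u) inj =
    All.map⁺ (All.tabulate λ y∈ eq → All.lookup x∉ y∈ (inj (here refl) (there y∈) eq)) ∷
    Unique-map f u (λ p q → inj (there p) (there q))

  length-≤-Fin : ∀ {D} (f : A → Fin D) {xs} → Unique xs →
                 (∀ {x y} → x ∈ xs → y ∈ xs → f x ≡ f y → x ≡ y) → length xs ≤ D
  length-≤-Fin {D} f {xs} u inj =
    subst₂ _≤_ (length-map f xs) (length-tabulate {n = D} _)
      (length-⊆ (Unique-map f u inj) (λ {i} _ → ∈-allFin i))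

  total-concatMap : ∀ {B : Set} (f : B → ℕ) (g : A → List B) xs →
                    total f (concatMap g xs) ≡ total (total f ∘ g) xs
  total-concatMap f g []       = refl
  total-concatMap f g (x ∷ xs) =
    trans (total-++ f (g x) _) (cong (total f (g x) +_) (total-concatMap f g xs))

  total-map : ∀ {B : Set} (f : B → ℕ) (g : A → B) xs → total f (map g xs) ≡ total (f ∘ g) xs
  total-map f g []       = refl
  total-map f g (x ∷ xs) = cong (f (g x) +_) (total-map f g xs)

  fibres : ∀ {B : Set} → (A → List B) → List A → List (A × B)
  fibres g = concatMap (λ x → map (x ,_) (g x))

  ∈-fibres⁺ : ∀ {B : Set} (g : A → List B) {xs x y} → x ∈ xs → y ∈ g x → (x , y) ∈ fibres g xs
  ∈-fibres⁺ g {x ∷ xs} (here refl) y∈ = ∈-++⁺ˡ (∈-map⁺ (x ,_) y∈)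
  ∈-fibres⁺ g {x ∷ xs} (there x∈)  y∈ = ∈-++⁺ʳ (map (x ,_) (g x)) (∈-fibres⁺ g x∈ y∈)

  ∈-fibres⁻ : ∀ {B : Set} (g : A → List B) xs {x y} → (x , y) ∈ fibres g xs → x ∈ xs × y ∈ g x
  ∈-fibres⁻ g (z ∷ xs) p with ∈-++⁻ (map (z ,_) (g z)) p
  ... | inj₁ q with ∈-map⁻ (z ,_) q
  ...   | _ , y∈ , refl = here refl , y∈
  ∈-fibres⁻ g (z ∷ xs) p | inj₂ q = let x∈ , y∈ = ∈-fibres⁻ g xs q in there x∈ , y∈

  Unique-fibres : ∀ {B : Set} (g : A → List B) {xs} → Unique xs → (∀ x → Unique (g x)) →
                  Unique (fibres g xs)
  Unique-fibres g {[]}     []       ug = []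
  Unique-fibres g {x ∷ xs} (x∉ ∷ u) ug =
    Unique.++⁺ (Unique.map⁺ ,-injectiveʳ (ug x)) (Unique-fibres g u ug) disj
    where
    disj : ∀ {v} → ¬ (v ∈ map (x ,_) (g x) × v ∈ fibres g xs)
    disj (p , q) with ∈-map⁻ (x ,_) p
    ... | _ , _ , refl = All.lookup x∉ (proj₁ (∈-fibres⁻ g xs q)) refl

  length-fibres : ∀ {B : Set} (g : A → List B) xs → length (fibres g xs) ≡ total (length ∘ g) xs
  length-fibres g []       = refl
  length-fibres g (x ∷ xs) = trans (length-++ (map (x ,_) (g x)))
    (cong₂ _+_ (length-map (x ,_) (g x)) (length-fibres g xs))

-- Every ordered adjacent pair is an edge or a reversed edge.
handshake : ∀ {n} (G : Graph n) → total (length ∘ N G) (allFin n) ≤ 2 * ∣E∣ G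
handshake {n} G = begin
  total (length ∘ N G) (allFin n)           ≡⟨ sym (length-fibres (N G) (allFin n)) ⟩
  length (fibres (N G) (allFin n))          ≤⟨ length-⊆ (Unique-fibres (N G) (Unique.allFin⁺ n) (N-unique G)) sub ⟩
  length (edges G ++ map swap (edges G))    ≡⟨ length-++ (edges G) ⟩
  ∣E∣ G + length (map swap (edges G))       ≡⟨ cong (∣E∣ G +_) (trans (length-map swap (edges G)) (sym (+-identityʳ _))) ⟩
  2 * ∣E∣ G                                 ∎
  where
  open ≤-Reasoning
  up : Fin n → List (Fin n)
  up u = filter (u <?_) (N G u)
  sub : ∀ {e} → e ∈ fibres (N G) (allFin n) → e ∈ edges G ++ map swap (edges G)
  sub {u , v} e∈ with ∈-fibres⁻ (N G) (allFin n) e∈ | Fin.<-cmp u v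
  ... | _ , v∈ | tri< u<v _ _ = ∈-++⁺ˡ (∈-fibres⁺ up (∈-allFin u) (∈-filter⁺ (u <?_) v∈ u<v))
  ... | _ , v∈ | tri≈ _ refl _ = contradiction v∈ (N-irrefl G u)
  ... | _ , v∈ | tri> _ _ v<u =
    ∈-++⁺ʳ (edges G) (∈-map⁺ swap (∈-fibres⁺ up (∈-allFin v) (∈-filter⁺ (v <?_) (N-sym G v∈) v<u)))

length-filter-split : ∀ {A : Set} {P : A → Set} (P? : Decidable P) xs →
  length xs ≡ length (filter P? xs) + length (filter (λ x → ¬? (P? x)) xs)
length-filter-split P? [] = refl
length-filter-split P? (x ∷ xs) with P? x
... | yes _ = cong suc (length-filter-split P? xs)
... | no _  = trans (cong suc (length-filter-split P? xs)) (sym (+-suc _ _))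

-- Ranking the nodes of a weighted tree

-- Base-two value of the lowest `j` digits. Digits above 1 are allowed because several subtrees at
-- one node may show the same level.
bits : ℕ → (ℕ → ℕ) → ℕ
bits zero    c = 0
bits (suc j) c = bits j c + c j * 2 ^ j

bits-mono : ∀ j {c d : ℕ → ℕ} → (∀ x → c x ≤ d x) → bits j c ≤ bits j d
bits-mono zero    h = z≤n
bits-mono (suc j) h = +-mono-≤ (bits-mono j h) (*-monoˡ-≤ (2 ^ j) (h j))

-- Add b to the numeral Σ c x 2^x with possibly large digits c x, keeping track only of whether
-- there is a carry. Where a carry meets the digit 0 it comes to rest: this is the new level.
data Choice (b : ℕ) (c : ℕ → ℕ) (j : ℕ) : Set where
  none  : b ≡ 0 → (∀ {x} → x < j → c x ≤ 1) → Choice b c j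
  some  : ∀ q → q < j → c q ≡ 0 → (∀ {x} → q < x → x < j → c x ≤ 1) →
          2 ^ q ≤ b + bits q c → Choice b c j
  carry : 2 ^ j ≤ b + bits j c → Choice b c j

<suc-cases : ∀ {x j} → x < suc j → x < j ⊎ x ≡ j
<suc-cases x<sj = m≤n⇒m<n∨m≡n (≤-pred x<sj)

-- The digits are read upwards. A digit of at least 2 sends out a carry of its own and overrides an
-- earlier resting place, so the `q` of `some` is the last one and the digits above it are at most
-- 1.
choose : ∀ b c j → Choice b c j
choose zero    c zero = none refl λ ()
choose (suc b) c zero = carry (s≤s z≤n)
choose b c (suc j) = go (choose b c j) (c j) refl
  where
  extend : ∀ {y} → c j ≡ y → y ≤ 1 → ∀ {P : ℕ → Set} → (∀ {x} → P x → x < j → c x ≤ 1) →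
           ∀ {x} → P x → x < suc j → c x ≤ 1
  extend eq y≤1 h Px x<sj with <suc-cases x<sj
  ... | inj₁ x<j  = h Px x<j
  ... | inj₂ refl = subst (_≤ 1) (sym eq) y≤1
  small : ∀ y → c j ≡ y → y ≤ 1 → Choice b c j → (2 ^ j ≤ b + bits j c → Choice b c (suc j)) → Choice b c (suc j)
  small y eq y≤1 (none b0 h)          k = none b0 λ x<sj → extend eq y≤1 {λ x → 0 ≤ x} (λ _ → h) z≤n x<sj
  small y eq y≤1 (some q q<j cq h le) k = some q (m<n⇒m<1+n q<j) cq (extend eq y≤1 h) le
  small y eq y≤1 (carry le)           k = k le
  2^suc : ∀ j → 2 ^ suc j ≡ 2 ^ j + 2 ^ j
  2^suc j = cong (2 ^ j +_) (+-identityʳ (2 ^ j))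
  go : Choice b c j → ∀ y → c j ≡ y → Choice b c (suc j)
  go ch zero eq = small 0 eq z≤n ch
    λ le → some j (n<1+n j) eq (λ j<x x<sj → ⊥-elim (<⇒≱ j<x (≤-pred x<sj))) le
  go ch (suc zero) eq = small 1 eq ≤-refl ch λ le → carry (begin
    2 ^ suc j                      ≡⟨ 2^suc j ⟩
    2 ^ j + 2 ^ j                  ≤⟨ +-mono-≤ le (≤-reflexive (sym (+-identityʳ (2 ^ j)))) ⟩
    b + bits j c + 1 * 2 ^ j       ≡⟨ cong (λ y → b + bits j c + y * 2 ^ j) (sym eq) ⟩
    b + bits j c + c j * 2 ^ j     ≡⟨ +-assoc b _ _ ⟩
    b + bits (suc j) c             ∎)
    where open ≤-Reasoning
  go ch (suc (suc y)) eq = carry (begin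
    2 ^ suc j                      ≤⟨ *-monoˡ-≤ (2 ^ j) {2} {suc (suc y)} (s≤s (s≤s z≤n)) ⟩
    suc (suc y) * 2 ^ j            ≡⟨ cong (_* 2 ^ j) (sym eq) ⟩
    c j * 2 ^ j                    ≤⟨ m≤n+m _ (bits j c) ⟩
    bits (suc j) c                 ≤⟨ m≤n+m _ b ⟩
    b + bits (suc j) c             ∎)
    where open ≤-Reasoning

-- The numeral after a carry has come to rest at `q`: a node given this level hides the smaller
-- levels behind it, shows its own and leaves the larger ones in view.
visible : ℕ → (ℕ → ℕ) → ℕ → ℕ
visible q c x with <-cmp x q
... | tri< _ _ _ = 0
... | tri≈ _ _ _ = 1
... | tri> _ _ _ = c x

visible-below : ∀ {q c x} → x < q → visible q c x ≡ 0
visible-below {q} {c} {x} x<q with <-cmp x q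
... | tri< _ _ _ = refl
... | tri≈ x≮q _ _ = contradiction x<q x≮q
... | tri> x≮q _ _ = contradiction x<q x≮q

visible-at : ∀ q c → visible q c q ≡ 1
visible-at q c with <-cmp q q
... | tri< _ q≢q _ = contradiction refl q≢q
... | tri≈ _ _ _ = refl
... | tri> _ q≢q _ = contradiction refl q≢q

visible-above : ∀ {q c x} → q < x → visible q c x ≡ c x
visible-above {q} {c} {x} q<x with <-cmp x q
... | tri< _ _ x≯q = contradiction q<x x≯q
... | tri≈ _ _ x≯q = contradiction q<x x≯q
... | tri> _ _ _ = refl

-- Setting digit `q` costs `2 ^ q`, which is paid by `b` and the erased digits below `q`; the digits
-- above `q` are the same on both sides.
bits-visible : ∀ {b q c} → 2 ^ q ≤ b + bits q c → ∀ j → q < j → bits j (visible q c) ≤ b + bits j c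
bits-visible {b} {q} {c} le (suc j) q<sj with <suc-cases q<sj
... | inj₁ q<j rewrite visible-above {q} {c} q<j = begin
  bits j (visible q c) + c j * 2 ^ j ≤⟨ +-monoˡ-≤ (c j * 2 ^ j) (bits-visible le j q<j) ⟩
  b + bits j c + c j * 2 ^ j         ≡⟨ +-assoc b _ _ ⟩
  b + bits (suc j) c                 ∎
  where open ≤-Reasoning
... | inj₂ refl rewrite visible-at q c = begin
  bits q (visible q c) + (2 ^ q + 0) ≡⟨ cong₂ _+_ (low q ≤-refl) (+-identityʳ (2 ^ q)) ⟩
  2 ^ q                              ≤⟨ le ⟩
  b + bits q c                       ≤⟨ +-monoʳ-≤ b (m≤m+n (bits q c) _) ⟩
  b + bits (suc q) c                 ∎
  where
  open ≤-Reasoning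
  low : ∀ i → i ≤ q → bits i (visible q c) ≡ 0
  low zero    _   = refl
  low (suc i) i<q rewrite visible-below {q} {c} i<q = trans (+-identityʳ _) (low i (<⇒≤ i<q))

-- The level of a tree node of weight b, given that c k of the subtrees below it show level suc k,
-- and the tokens for the levels that show above it. Level 0 means that the node is unranked.
record Assigned (K b : ℕ) (c : ℕ → ℕ) : Set where
  field
    level   : ℕ
    tokens  : ℕ → ℕ
    level≤  : level ≤ K
    ranked  : 0 < b → 0 < level
    fresh   : ∀ {k} → level ≡ suc k → c k ≡ 0
    dup     : ∀ {k} → k < K → 2 ≤ c k → suc k < level
    kept    : ∀ {k} → level ≡ suc k ⊎ 1 ≤ c k → level ≤ suc k → 1 ≤ tokens k
    bounded : bits K tokens ≤ b + bits K c

-- The bound excludes a carry out of the top digit, so a carry has to rest below `K`. Levels are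
-- digits shifted by one because 0 means unranked.
assign : ∀ K b c → b + bits K c < 2 ^ K → Assigned K b c
assign K b c small with choose b c K
... | none b0 h = record
  { level   = 0
  ; tokens  = c
  ; level≤  = z≤n
  ; ranked  = λ b>0 → contradiction b0 (>⇒≢ b>0)
  ; fresh   = λ ()
  ; dup     = λ k<K two → contradiction (h k<K) (<⇒≱ two)
  ; kept    = λ { (inj₂ c≥1) _ → c≥1 }
  ; bounded = m≤n+m _ b
  }
... | carry le = contradiction le (<⇒≱ small)
... | some q q<K cq h le = record
  { level   = suc q
  ; tokens  = visible q c
  ; level≤  = q<K
  ; ranked  = λ _ → s≤s z≤n
  ; fresh   = λ { refl → cq }
  ; dup     = dup′
  ; kept    = kept′
  ; bounded = bits-visible le K q<K
  }
  where
  dup′ : ∀ {k} → k < K → 2 ≤ c k → suc k < suc q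
  dup′ {k} k<K two with <-cmp k q
  ... | tri< k<q _ _ = s≤s k<q
  ... | tri≈ _ refl _ = contradiction (subst (2 ≤_) cq two) λ ()
  ... | tri> _ _ q<k = contradiction (h q<k k<K) (<⇒≱ two)
  kept′ : ∀ {k} → suc q ≡ suc k ⊎ 1 ≤ c k → suc q ≤ suc k → 1 ≤ visible q c k
  kept′ (inj₁ refl) _ = ≤-reflexive (sym (visible-at q c))
  kept′ {k} (inj₂ c≥1) q≤k with m≤n⇒m<n∨m≡n (≤-pred q≤k)
  ... | inj₁ q<k  = subst (1 ≤_) (sym (visible-above q<k)) c≥1
  ... | inj₂ refl = ≤-reflexive (sym (visible-at q c))

-- Eliminating a tree leaf by leaf

infix 4 _∈?_

_∈?_ : ∀ {n} (x : Fin n) (xs : List (Fin n)) → Dec (x ∈ xs)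
_∈?_ = DecMembership._∈?_ _≟_

length-Unique : ∀ {n} {xs : List (Fin n)} → Unique xs → length xs ≤ n
length-Unique u = length-≤-Fin id u (λ _ _ eq → eq)

module _ {n : ℕ} (T : Graph n) where

  -- Each node has at most one neighbour among the nodes after it. In a forest this is an order in
  -- which leaves, or isolated nodes, are stripped off.
  data Elimination : List (Fin n) → Set where
    []   : Elimination []
    leaf : ∀ {t S} → t ∉ S →
           (∀ {s s′} → s ∈ S → s′ ∈ S → Adj T t s → Adj T t s′ → s ≡ s′) →
           Elimination S → Elimination (t ∷ S)

  Elimination⇒Unique : ∀ {S} → Elimination S → Unique S
  Elimination⇒Unique []             = []
  Elimination⇒Unique (leaf t∉ _ el) = All.¬Any⇒All¬ _ t∉ ∷ Elimination⇒Unique el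

  start∈vertices : ∀ {u v} (p : Walk T u v) → u ∈ vertices T p
  start∈vertices ε       = here refl
  start∈vertices (_ ◅ _) = here refl

  prefix : ∀ {u v s} (p : Walk T u v) → s ∈ vertices T p → Unique (vertices T p) →
           Σ (Walk T u s) λ q → Unique (vertices T q) × (∀ {x} → x ∈ vertices T q → x ∈ vertices T p)
  prefix ε       (here refl) u        = ε , u , id
  prefix (e ◅ p) (here refl) u        = ε , [] ∷ [] , λ { (here refl) → here refl }
  prefix (e ◅ p) (there s∈)  (u∉ ∷ u) with prefix p s∈ u
  ... | q , uq , sub = e ◅ q , All.tabulate (λ x∈ → All.lookup u∉ (sub x∈)) ∷ uq ,
                       λ { (here refl) → here refl ; (there x∈) → there (sub x∈) }

  module _ (acyclic : Acyclic T) where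

    -- If `s` lay beyond the second vertex, the path up to `s` and the edge back to `t` would form a
    -- cycle.
    neighbour-on-path : ∀ {t y z s} (e : Adj T t y) (p : Walk T y z) → Unique (vertices T (e ◅ p)) →
                        Adj T t s → s ∈ vertices T (e ◅ p) → s ≡ y
    neighbour-on-path e p u ts (here refl) = contradiction ts (N-irrefl T _)
    neighbour-on-path e ε u ts (there (here eq)) = eq
    neighbour-on-path e (e′ ◅ p) u ts (there (here eq)) = eq
    neighbour-on-path e (e′ ◅ p) ((_ ∷ t∉) ∷ y∉ ∷ u) ts (there (there s∈)) with prefix p s∈ u
    ... | q , uq , sub = contradiction (N-sym T ts) (acyclic (e ◅ e′ ◅ q)
            (((λ { refl → N-irrefl T _ e }) ∷ All.tabulate (λ x∈ → All.lookup t∉ (sub x∈))) ∷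
             All.tabulate (λ x∈ → All.lookup y∉ (sub x∈)) ∷ uq)
            (s≤s (s≤s (∈-length (start∈vertices q)))))

    -- The path grows at its front through neighbours in `S` that it has not met. Being simple, it
    -- has at most `n` vertices, so it gets stuck before `fuel` is used up. Then all neighbours of
    -- its first vertex in `S` lie on the path, and `neighbour-on-path` makes them equal.
    extend-to-leaf : ∀ S fuel {t z} (p : Walk T t z) → t ∈ S → Unique (vertices T p) →
      n < fuel + length (vertices T p) →
      ∃ λ t → t ∈ S × (∀ {s s′} → s ∈ S → s′ ∈ S → Adj T t s → Adj T t s′ → s ≡ s′)
    extend-to-leaf S zero p t∈ u long = contradiction (length-Unique u) (<⇒≱ long)
    extend-to-leaf S (suc fuel) {t} p t∈ u long
      with Any.any? (λ w → (w ∈? S) ×-dec ¬? (w ∈? vertices T p)) (N T t)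
    ... | yes found =
      let w , tw , w∈ , w∉ = find found in
      extend-to-leaf S fuel (N-sym T tw ◅ p) w∈ (All.¬Any⇒All¬ _ w∉ ∷ u)
        (≤-trans long (≤-reflexive (sym (+-suc fuel _))))
    ... | no stuck = t , t∈ , λ s∈ s′∈ ts ts′ → same p u ts ts′ (on-path s∈ ts) (on-path s′∈ ts′)
      where
      on-path : ∀ {s} → s ∈ S → Adj T t s → s ∈ vertices T p
      on-path {s} s∈ ts = decidable-stable (s ∈? vertices T p)
        λ s∉ → stuck (lose ts (s∈ , s∉))
      same : ∀ {z s s′} (p : Walk T t z) → Unique (vertices T p) → Adj T t s → Adj T t s′ →
             s ∈ vertices T p → s′ ∈ vertices T p → s ≡ s′
      same ε       u ts ts′ (here refl) _   = contradiction ts (N-irrefl T _)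
      same (e ◅ p) u ts ts′ s∈          s′∈ =
        trans (neighbour-on-path e p u ts s∈) (sym (neighbour-on-path e p u ts′ s′∈))

    eliminate : ∀ fuel S → length S ≤ fuel →
                ∃ λ S′ → Elimination S′ × (∀ {s} → s ∈ S → s ∈ S′) × (∀ {s} → s ∈ S′ → s ∈ S)
    eliminate _ [] _ = [] , [] , id , id
    eliminate (suc fuel) S@(r ∷ _) len≤
      with extend-to-leaf S n (ε {x = r}) (here refl) ([] ∷ []) (≤-reflexive (+-comm 1 n))
    ... | t , t∈ , unique
      with eliminate fuel (filter (λ s → ¬? (s ≟ t)) S)
             (≤-pred (≤-trans (filter-notAll (λ s → ¬? (s ≟ t)) S (Any.map (λ { refl ¬t → ¬t refl }) t∈)) len≤))
    ...   | S′ , el , sub , sup = t ∷ S′ , leaf t∉ unique′ el , sub′ , sup′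
      where
      sup″ : ∀ {s} → s ∈ S′ → s ∈ S × s ≢ t
      sup″ s∈ = ∈-filter⁻ (λ s → ¬? (s ≟ t)) (sup s∈)
      t∉ : t ∉ S′
      t∉ t∈ = proj₂ (sup″ t∈) refl
      unique′ : ∀ {s s′} → s ∈ S′ → s′ ∈ S′ → Adj T t s → Adj T t s′ → s ≡ s′
      unique′ s∈ s′∈ = unique (proj₁ (sup″ s∈)) (proj₁ (sup″ s′∈))
      sub′ : ∀ {s} → s ∈ S → s ∈ t ∷ S′
      sub′ {s} s∈ with s ≟ t
      ... | yes refl = here refl
      ... | no s≢t   = there (sub (∈-filter⁺ (λ s → ¬? (s ≟ t)) s∈ s≢t))
      sup′ : ∀ {s} → s ∈ t ∷ S′ → s ∈ S
      sup′ (here refl) = t∈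
      sup′ (there s∈)  = proj₁ (sup″ s∈)

-- Ranking along an elimination order

bits-+ : ∀ j (c d : ℕ → ℕ) → bits j (λ x → c x + d x) ≡ bits j c + bits j d
bits-+ zero    c d = refl
bits-+ (suc j) c d = trans (cong₂ _+_ (bits-+ j c d) (*-distribʳ-+ (2 ^ j) (c j) (d j)))
                           (interchange (bits j c) _ _ _)

module Levels {n : ℕ} (T : Graph n) (K : ℕ) (weight : Fin n → ℕ) where

  Colours : Set
  Colours = Fin n → ℕ → ℕ

  -- An eliminated subtree is represented by tokens at the node where it was attached. Stating
  -- `apart` for tokens, and not only for levels, lets the induction speak about nodes that are
  -- already gone.
  Token : (Fin n → ℕ) → Colours → Fin n → ℕ → Set
  Token ℓ acc t k = ℓ t ≡ suc k ⊎ 1 ≤ acc t k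

  Low : List (Fin n) → (Fin n → ℕ) → ℕ → Fin n → Fin n → Set
  Low S ℓ k a b = (a ∈ S × ℓ a ≤ suc k) × Adj T a b × (b ∈ S × ℓ b ≤ suc k)

  Low-sym : ∀ {S ℓ k a b} → Low S ℓ k a b → Low S ℓ k b a
  Low-sym (a , e , b) = b , N-sym T e , a

  -- acc t k counts the eliminated subtrees at t with a node of level suc k that can be reached
  -- from t through levels at most suc k.
  record Ranking (S : List (Fin n)) (acc : Colours) : Set where
    field
      ℓ      : Fin n → ℕ
      ℓ≤     : ∀ t → ℓ t ≤ K
      ranked : ∀ {t} → t ∈ S → 0 < weight t → 0 < ℓ t
      fresh  : ∀ {t k} → t ∈ S → ℓ t ≡ suc k → acc t k ≡ 0
      dup    : ∀ {t k} → t ∈ S → k < K → 2 ≤ acc t k → suc k < ℓ t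
      apart  : ∀ {a b k} → a ∈ S → b ∈ S → k < K → Token ℓ acc a k → Token ℓ acc b k →
               Star (Low S ℓ k) a b → a ≡ b

  potential : Colours → Fin n → ℕ
  potential acc s = weight s + bits K (acc s)

  attach : Fin n → (ℕ → ℕ) → Colours → Colours
  attach t tok acc s with s ∈? N T t
  ... | yes _ = λ k → tok k + acc s k
  ... | no  _ = acc s

  attach-adj : ∀ {t tok acc s} → Adj T t s → ∀ k → attach t tok acc s k ≡ tok k + acc s k
  attach-adj {t} {s = s} ts k with s ∈? N T t
  ... | yes _  = refl
  ... | no ¬ts = contradiction ts ¬ts

  attach-≥ : ∀ t tok acc s k → acc s k ≤ attach t tok acc s k
  attach-≥ t tok acc s k with s ∈? N T t
  ... | yes _ = m≤n+m _ (tok k)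
  ... | no  _ = ≤-refl

  -- At most one node of `S` is adjacent to `t`, so the tokens of `t` are added at most once.
  -- Together with `bounded`, this keeps the total potential from growing when a leaf is removed.
  potential-attach : ∀ t tok acc S → Unique S →
    (∀ {s s′} → s ∈ S → s′ ∈ S → Adj T t s → Adj T t s′ → s ≡ s′) →
    total (potential (attach t tok acc)) S ≤ bits K tok + total (potential acc) S
  potential-attach t tok acc []      u        one = z≤n
  potential-attach t tok acc (s ∷ S) (s∉ ∷ u) one with s ∈? N T t
  ... | no _ = begin
    potential acc s + total (potential (attach t tok acc)) S
      ≤⟨ +-monoʳ-≤ (potential acc s) (potential-attach t tok acc S u λ p q → one (there p) (there q)) ⟩
    potential acc s + (bits K tok + total (potential acc) S)
      ≡⟨ x∙yz≈y∙xz (potential acc s) (bits K tok) _ ⟩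
    bits K tok + (potential acc s + total (potential acc) S) ∎
    where
    open ≤-Reasoning
  ... | yes ts = begin
    weight s + bits K (λ k → tok k + acc s k) + total (potential (attach t tok acc)) S
      ≤⟨ +-monoʳ-≤ _ (total-mono _ _ S (≤-reflexive ∘ others)) ⟩
    weight s + bits K (λ k → tok k + acc s k) + total (potential acc) S
      ≡⟨ cong (λ x → weight s + x + total (potential acc) S) (bits-+ K tok (acc s)) ⟩
    weight s + (bits K tok + bits K (acc s)) + total (potential acc) S
      ≡⟨ cong (_+ total (potential acc) S) (x∙yz≈y∙xz (weight s) (bits K tok) _) ⟩
    bits K tok + potential acc s + total (potential acc) S
      ≡⟨ +-assoc (bits K tok) _ _ ⟩
    bits K tok + (potential acc s + total (potential acc) S) ∎
    where
    open ≤-Reasoning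
    others : ∀ {s′} → s′ ∈ S → potential (attach t tok acc) s′ ≡ potential acc s′
    others {s′} s′∈ with s′ ∈? N T t
    ... | yes ts′ = contradiction (one (here refl) (there s′∈) ts ts′) (All.lookup s∉ s′∈)
    ... | no  _   = refl

  -- The leaf gets its level first, from the tokens that have arrived at it. The tokens it shows are
  -- handed to its neighbour in `S`, and the rest is ranked with them. As the total potential does
  -- not grow, `assign` always meets a numeral below `2 ^ K`.
  rank : ∀ {S} → Elimination T S → ∀ acc → total (potential acc) S < 2 ^ K → Ranking S acc
  rank [] acc small = record
    { ℓ = const 0 ; ℓ≤ = λ _ → z≤n ; ranked = λ () ; fresh = λ () ; dup = λ () ; apart = λ () }
  rank (leaf {t} {S} t∉ one el) acc small = record
    { ℓ = ℓ ; ℓ≤ = ℓ≤ ; ranked = ranked ; fresh = fresh ; dup = dup ; apart = apart }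
    where
    module A = Assigned (assign K (weight t) (acc t) (≤-<-trans (m≤m+n _ _) small))
    acc′ : Colours
    acc′ = attach t A.tokens acc
    module R = Ranking (rank el acc′ (≤-<-trans
      (≤-trans (potential-attach t A.tokens acc S (Elimination⇒Unique T el) one) (+-monoˡ-≤ _ A.bounded)) small))

    ℓ : Fin n → ℕ
    ℓ s with s ≟ t
    ... | yes _ = A.level
    ... | no  _ = R.ℓ s

    ℓ-leaf : ℓ t ≡ A.level
    ℓ-leaf with t ≟ t
    ... | yes _  = refl
    ... | no t≢t = contradiction refl t≢t

    ℓ-rest : ∀ {s} → s ∈ S → ℓ s ≡ R.ℓ s
    ℓ-rest {s} s∈ with s ≟ t
    ... | yes refl = contradiction s∈ t∉
    ... | no _     = refl

    ℓ≤ : ∀ s → ℓ s ≤ K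
    ℓ≤ s with s ≟ t
    ... | yes _ = A.level≤
    ... | no  _ = R.ℓ≤ s

    ranked : ∀ {s} → s ∈ t ∷ S → 0 < weight s → 0 < ℓ s
    ranked (here refl) w = subst (0 <_) (sym ℓ-leaf) (A.ranked w)
    ranked (there s∈)  w = subst (0 <_) (sym (ℓ-rest s∈)) (R.ranked s∈ w)

    fresh : ∀ {s k} → s ∈ t ∷ S → ℓ s ≡ suc k → acc s k ≡ 0
    fresh (here refl) eq = A.fresh (trans (sym ℓ-leaf) eq)
    fresh {s} {k} (there s∈) eq = n≤0⇒n≡0
      (≤-trans (attach-≥ t A.tokens acc s k) (≤-reflexive (R.fresh s∈ (trans (sym (ℓ-rest s∈)) eq))))

    dup : ∀ {s k} → s ∈ t ∷ S → k < K → 2 ≤ acc s k → suc k < ℓ s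
    dup (here refl) k<K two = subst (_ <_) (sym ℓ-leaf) (A.dup k<K two)
    dup {s} {k} (there s∈) k<K two =
      subst (_ <_) (sym (ℓ-rest s∈)) (R.dup s∈ k<K (≤-trans two (attach-≥ t A.tokens acc s k)))

    token-rest : ∀ {s k} → s ∈ S → Token ℓ acc s k → Token R.ℓ acc′ s k
    token-rest s∈ (inj₁ eq) = inj₁ (trans (sym (ℓ-rest s∈)) eq)
    token-rest s∈ (inj₂ c)  = inj₂ (≤-trans c (attach-≥ t A.tokens acc _ _))

    -- Since `t` has at most one neighbour in `S`, a visit to `t` on the way can be cut out, and a
    -- walk that starts at `t` enters `S` through that neighbour.
    ascend : ∀ {a b k} → Star (Low (t ∷ S) ℓ k) a b → b ∈ S →
             (a ∈ S → Star (Low S R.ℓ k) a b) ×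
             (a ≡ t → ∃ λ s → s ∈ S × Adj T t s × ℓ t ≤ suc k × R.ℓ s ≤ suc k × Star (Low S R.ℓ k) s b)
    ascend ε b∈ = (λ _ → ε) , λ { refl → contradiction b∈ t∉ }
    ascend {a} {b} {k} (_◅_ {j = c} ((_ , a≤) , e , (c∈ , c≤)) p) b∈ with ascend p b∈ | c∈
    ... | _ , onLeaf | here refl = fromRest , λ { refl → contradiction e (N-irrefl T t) }
      where
      fromRest : a ∈ S → Star (Low S R.ℓ k) a b
      fromRest a∈ with onLeaf refl
      ... | s , s∈ , ts , _ , _ , q with one a∈ s∈ (N-sym T e) ts
      ...   | refl = q
    ... | onRest , _ | there c∈S =
      (λ a∈ → ((a∈ , subst (_≤ suc k) (ℓ-rest a∈) a≤) , e , (c∈S , c≤′)) ◅ onRest c∈S) ,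
      λ { refl → c , c∈S , e , a≤ , c≤′ , onRest c∈S }
      where
      c≤′ : R.ℓ c ≤ suc k
      c≤′ = subst (_≤ suc k) (ℓ-rest c∈S) c≤

    kept : ∀ {k} → Token ℓ acc t k → ℓ t ≤ suc k → 1 ≤ A.tokens k
    kept {k} tok t≤ = A.kept (level-token tok) (subst (_≤ suc k) ℓ-leaf t≤)
      where
      level-token : Token ℓ acc t k → A.level ≡ suc k ⊎ 1 ≤ acc t k
      level-token (inj₁ eq) = inj₁ (trans (sym ℓ-leaf) eq)
      level-token (inj₂ c)  = inj₂ c

    -- The walk enters `S` at a neighbour `s`, which has received the token that `t` keeps, so
    -- `R.apart` gives `s ≡ b`. Then `b` has this token besides its own. If its own is its level,
    -- `R.fresh` fails; otherwise two tokens have arrived and `R.dup` puts `b` above level `suc k`,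
    -- although the walk is low.
    leaf-apart : ∀ {b k} → b ∈ S → k < K → Token ℓ acc t k → Token ℓ acc b k →
                 Star (Low (t ∷ S) ℓ k) t b → ⊥
    leaf-apart {b} {k} b∈ k<K tokₜ tokᵦ p with proj₂ (ascend p b∈) refl
    ... | s , s∈ , ts , t≤ , s≤ , q
      with R.apart s∈ b∈ k<K
             (inj₂ (subst (1 ≤_) (sym (attach-adj ts k)) (≤-trans (kept tokₜ t≤) (m≤m+n _ _))))
             (token-rest b∈ tokᵦ) q
    ...   | refl = clash tokᵦ
      where
      clash : Token ℓ acc b k → ⊥
      clash (inj₁ eq) = n≮0 (≤-trans (≤-trans (kept tokₜ t≤) (m≤m+n _ (acc b k)))
        (≤-reflexive (trans (sym (attach-adj ts k)) (R.fresh b∈ (trans (sym (ℓ-rest b∈)) eq)))))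
      clash (inj₂ c)  = <⇒≱ (R.dup b∈ k<K
        (≤-trans (+-mono-≤ (kept tokₜ t≤) c) (≤-reflexive (sym (attach-adj ts k))))) s≤

    apart : ∀ {a b k} → a ∈ t ∷ S → b ∈ t ∷ S → k < K → Token ℓ acc a k → Token ℓ acc b k →
            Star (Low (t ∷ S) ℓ k) a b → a ≡ b
    apart (here refl) (here refl) k<K ta tb p = refl
    apart (here refl) (there b∈)  k<K ta tb p = ⊥-elim (leaf-apart b∈ k<K ta tb p)
    apart (there a∈)  (here refl) k<K ta tb p =
      ⊥-elim (leaf-apart a∈ k<K tb ta (Star.reverse (λ {x} {y} → Low-sym {ℓ = ℓ}) p))
    apart (there a∈)  (there b∈)  k<K ta tb p =
      R.apart a∈ b∈ k<K (token-rest a∈ ta) (token-rest b∈ tb) (proj₁ (ascend p b∈) a∈)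

-- From levels to a centred colouring

data Route {n} (G : Graph n) (Q : Fin n → Set) (u : Fin n) : Fin n → ℕ → Set where
  stay   : Q u → Route G Q u u 0
  extend : ∀ {y v d} → Route G Q u y d → Adj G y v → Q v → Route G Q u v (suc d)

-- A centred colouring, with the smallest colour of a connected set occurring once.
Centred : ∀ {n D} → Graph n → (Fin n → Fin D) → Set
Centred G κ = ∀ {u v d} → Route G (λ x → κ u Fin.≤ κ x) u v d → κ u ≡ κ v → u ≡ v

position : ∀ {n} → Subset n → Fin n → ℕ
position (_ ∷ p)       zero    = 0
position (outside ∷ p) (suc v) = position p v
position (inside ∷ p)  (suc v) = suc (position p v)

position< : ∀ {n} {p : Subset n} {v} → v ∈ˢ p → position p v < ∣ p ∣
position< {p = inside ∷ p}  {zero}  here      = s≤s z≤n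
position< {p = outside ∷ p} {suc v} (there i) = position< i
position< {p = inside ∷ p}  {suc v} (there i) = s≤s (position< i)

position-injective : ∀ {n} {p : Subset n} {u v} → u ∈ˢ p → v ∈ˢ p → position p u ≡ position p v → u ≡ v
position-injective {u = zero}  {zero}  here here eq = refl
position-injective {p = outside ∷ p} (there i) (there j) eq = cong suc (position-injective i j eq)
position-injective {p = inside ∷ p}  (there i) (there j) eq = cong suc (position-injective i j (suc-injective eq))

bits-0 : ∀ j → bits j (const 0) ≡ 0
bits-0 zero    = refl
bits-0 (suc j) = trans (+-identityʳ _) (bits-0 j)

module Colouring {n : ℕ} (G : Graph n) (T : TreeDecomposition G) (K : ℕ) (n<2^K : n < 2 ^ K) where
  open TreeDecomposition T hiding (width)
  open IsTree isTree

  home : Fin n → Fin nodes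
  home v = proj₁ (covers-V v)

  residents : Fin nodes → List (Fin n)
  residents t = filter (λ v → home v ≟ t) (allFin n)

  open Levels tree K (length ∘ residents) public

  elimination : ∃ λ S → Elimination tree S × (∀ {s} → s ∈ allFin nodes → s ∈ S) × (∀ {s} → s ∈ S → s ∈ allFin nodes)
  elimination = eliminate tree acyclic (length (allFin nodes)) (allFin nodes) ≤-refl

  S : List (Fin nodes)
  S = proj₁ elimination

  ∈S : ∀ t → t ∈ S
  ∈S t = proj₁ (proj₂ (proj₂ elimination)) (∈-allFin t)

  -- There are no tokens yet, so only the weights count, and every vertex of `G` is resident at one
  -- node only, its home.
  total-potential : total (potential (λ _ _ → 0)) S ≤ n
  total-potential = begin
    total (potential (λ _ _ → 0)) S  ≤⟨ total-mono _ _ S (λ {s} _ → ≤-reflexive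
                                         (trans (cong (length (residents s) +_) (bits-0 K)) (+-identityʳ _))) ⟩
    total (length ∘ residents) S     ≡⟨ sym (length-fibres residents S) ⟩
    length (fibres residents S)      ≤⟨ length-≤-Fin proj₂
                                          (Unique-fibres residents (Elimination⇒Unique tree (proj₁ (proj₂ elimination)))
                                            (λ t → Unique.filter⁺ (λ v → home v ≟ t) (Unique.allFin⁺ n)))
                                          same-home ⟩
    n ∎
    where
    open ≤-Reasoning
    at-home : ∀ {t v} → (t , v) ∈ fibres residents S → home v ≡ t
    at-home {t} {v} p = proj₂ (∈-filter⁻ (λ v → home v ≟ t) {v} {allFin n} (proj₂ (∈-fibres⁻ residents S p)))
    same-home : ∀ {x y} → x ∈ fibres residents S → y ∈ fibres residents S → proj₂ x ≡ proj₂ y → x ≡ y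
    same-home {t , v} {t′ , .v} p q refl = cong (_, v) (trans (sym (at-home p)) (at-home q))

  open Ranking (rank (proj₁ (proj₂ elimination)) (λ _ _ → 0) (≤-<-trans total-potential n<2^K))

  bags : Fin n → List (Fin nodes)
  bags v = filter (λ t → v ∈ˢ? bag t) (allFin nodes)

  -- `home v` is the default of `argmax`; as its bag contains `v`, the result is a node whose bag
  -- contains `v` in every case.
  top : Fin n → Fin nodes
  top v = argmax ℓ (home v) (bags v)

  v∈top : ∀ v → v ∈ˢ bag (top v)
  v∈top v = argmax-all ℓ {P = λ t → v ∈ˢ bag t} (proj₂ (covers-V v)) (All.all-filter (λ t → v ∈ˢ? bag t) (allFin nodes))

  level : Fin n → ℕ
  level v = ℓ (top v)

  ℓ≤level : ∀ {v t} → v ∈ˢ bag t → ℓ t ≤ level v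
  ℓ≤level {v} {t} v∈ = All.lookup (f[xs]≤f[argmax] {f = ℓ} (home v) (bags v))
    (∈-filter⁺ (λ t → v ∈ˢ? bag t) (∈-allFin t) v∈)

  -- The home of `v` has `v` among its residents, hence a positive weight and therefore a positive
  -- level.
  level>0 : ∀ v → 0 < level v
  level>0 v = ≤-trans
    (ranked (∈S (home v)) (∈-length (∈-filter⁺ (λ u → home u ≟ home v) (∈-allFin v) refl)))
    (ℓ≤level (proj₂ (covers-V v)))

  level≤K : ∀ v → level v ≤ K
  level≤K v = ℓ≤ (top v)

  ∣bag∣≤ : ∀ t → ∣ bag t ∣ ≤ suc (width T)
  ∣bag∣≤ t = ≤-trans (All.lookup (xs≤max 0 (map (∣_∣ ∘ bag) (allFin nodes))) (∈-map⁺ (∣_∣ ∘ bag) (∈-allFin t)))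
    (m≤n+m∸n _ 1)

  -- Reversed, so that vertices of large level get small colours. As levels lie between 1 and `K`,
  -- the value `K ∸ level v` is below `K`.
  outer : Fin n → Fin K
  outer v = fromℕ< (∸-monoʳ-< (level>0 v) (level≤K v))

  inner : Fin n → Fin (suc (width T))
  inner v = fromℕ< (<-≤-trans (position< (v∈top v)) (∣bag∣≤ (top v)))

  colour : Fin n → Fin (K * suc (width T))
  colour v = Fin.combine (outer v) (inner v)

  colour≤⇒level≥ : ∀ {u v} → colour u Fin.≤ colour v → level v ≤ level u
  colour≤⇒level≥ {u} {v} le = ≮⇒≥ λ lt → <⇒≱ (Fin.combine-monoˡ-< {i = outer v} {j = outer u} (inner v) (inner u)
    (subst₂ _<_ (sym (Fin.toℕ-fromℕ< _)) (sym (Fin.toℕ-fromℕ< _)) (∸-monoʳ-< lt (level≤K v)))) le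

  module _ {k} (Q : Fin n → Set) (low : ∀ {x s} → Q x → x ∈ˢ bag s → ℓ s ≤ suc k) where

    lowWalk : ∀ {x} → Q x → ∀ {t t′} (p : Walk tree t t′) → All (λ s → x ∈ˢ bag s) (vertices tree p) →
              Star (Low S ℓ k) t t′
    lowWalk q ε       _              = ε
    lowWalk {x} q (e ◅ p) (x∈ ∷ x∈p) =
      ((∈S _ , low q x∈) , e , (∈S _ , low q (All.lookup x∈p (start∈vertices tree p)))) ◅ lowWalk q p x∈p

    -- Consecutive vertices of the route share a bag, and the bags of one vertex are joined inside
    -- its subtree; `low` keeps all these nodes at levels up to `suc k`.
    treeWalk : ∀ {u v d} → Route G Q u v d → ∀ {t t′} → u ∈ˢ bag t → v ∈ˢ bag t′ → Star (Low S ℓ k) t t′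
    treeWalk (stay q) u∈ v∈ = let p , al = subtree _ u∈ v∈ in lowWalk q p al
    treeWalk (extend ρ e q) u∈ v∈ =
      let s , y∈ , v∈s = covers-E e
          p , al       = subtree _ v∈s v∈
      in treeWalk ρ u∈ y∈ ◅◅ lowWalk q p al

  level-outer : ∀ {u v} → outer u ≡ outer v → level u ≡ level v
  level-outer {u} {v} eq = ∸-cancelˡ-≡ (level≤K u) (level≤K v) (Fin.fromℕ<-injective _ _ _ _ eq)

  -- No vertex of the route has a level above that of `u`, so `treeWalk` joins the two top nodes
  -- through low nodes. Both have level `suc k`, hence `apart` identifies them, and equal positions
  -- in one bag mean equal vertices.
  colour-centred : Centred G colour
  colour-centred {u} {v} ρ eq = position-injective (subst (λ t → u ∈ˢ bag t) top≡ (v∈top u)) (v∈top v)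
    (trans (cong (λ t → position (bag t) u) (sym top≡)) (Fin.fromℕ<-injective _ _ _ _ (proj₂ parts)))
    where
    parts : outer u ≡ outer v × inner u ≡ inner v
    parts = Fin.combine-injective (outer u) (inner u) (outer v) (inner v) eq
    k : ℕ
    k = pred (level u)
    level-u : level u ≡ suc k
    level-u = sym (suc-pred (level u) {{>-nonZero (level>0 u)}})
    k<K : k < K
    k<K = ≤-trans (≤-reflexive (sym level-u)) (level≤K u)
    top≡ : top u ≡ top v
    top≡ = apart (∈S _) (∈S _) k<K (inj₁ level-u) (inj₁ (trans (sym (level-outer (proj₁ parts))) level-u))
      (treeWalk (λ x → colour u Fin.≤ colour x)
        (λ q x∈ → ≤-trans (ℓ≤level x∈) (≤-trans (colour≤⇒level≥ q) (≤-reflexive level-u)))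
        ρ (v∈top u) (v∈top v))

-- Vertex orders that sort a key

sort : ∀ {n} (f : Fin n → ℕ) → ∃ λ (σ : Permutation′ n) → ∀ {i j} → i Fin.≤ j → f (σ ⟨$⟩ʳ i) ≤ f (σ ⟨$⟩ʳ j)
sort {zero}  f = Perm.id , λ { {()} }
sort {suc n} f with sort (f ∘ punchIn (argmin f zero (allFin (suc n))))
-- A vertex of least key goes first; the others, reindexed by `punchIn`, are sorted recursively.
... | σ , mono = insert zero m σ , sorted
  where
  m : Fin (suc n)
  m = argmin f zero (allFin (suc n))
  least : ∀ i → f m ≤ f i
  least i = All.lookup (f[argmin]≤f[xs] {f = f} zero (allFin (suc n))) (∈-allFin i)
  sorted : ∀ {i j} → i Fin.≤ j → f (insert zero m σ ⟨$⟩ʳ i) ≤ f (insert zero m σ ⟨$⟩ʳ j)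
  sorted {zero}  _ = least _
  sorted {suc i} {suc j} (s≤s i≤j) =
    subst₂ (λ x y → f x ≤ f y) (sym (insert-punchIn zero m σ i)) (sym (insert-punchIn zero m σ j)) (mono i≤j)

sorted-rank : ∀ {n} (f : Fin n → ℕ) (σ : Permutation′ n) →
  (∀ {i j} → i Fin.≤ j → f (σ ⟨$⟩ʳ i) ≤ f (σ ⟨$⟩ʳ j)) →
  ∀ {u v} → f u < f v → σ ⟨$⟩ˡ u Fin.< σ ⟨$⟩ˡ v
sorted-rank f σ mono lt = ≰⇒> λ ge → <⇒≱ lt
  (subst₂ (λ x y → f x ≤ f y) (inverseʳ σ) (inverseʳ σ) (mono ge))

-- Queries and merging

minimum : List ℕ → ℕ∞
minimum = foldr (λ δ q → [ δ ] ⊓∞ q) ∞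

minimum≤ : ∀ {δ δs} → δ ∈ δs → minimum δs ≤⁺ [ δ ]
minimum≤ {δs = δ ∷ δs} (here refl) with minimum δs
... | ∞     = [ ≤-refl ]
... | [ q ] = [ m⊓n≤m δ q ]
minimum≤ {δs = δ′ ∷ δs} (there δ∈) with minimum δs | minimum≤ δ∈
... | [ q ] | [ q≤δ ] = [ ≤-trans (m⊓n≤n δ′ q) q≤δ ]

minimum-attained : ∀ {d} δs → minimum δs ≤⁺ [ d ] → ∃ λ δ → δ ∈ δs × δ ≤ d
minimum-attained (δ ∷ δs) le with minimum δs | minimum-attained δs | le
... | ∞     | _   | [ δ≤d ] = δ , here refl , δ≤d
... | [ q ] | rec | [ m≤d ] with ⊓-sel δ q
...   | inj₁ eq = δ , here refl , subst (_≤ _) eq m≤d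
...   | inj₂ eq = let δ′ , δ′∈ , δ′≤d = rec [ subst (_≤ _) eq m≤d ] in δ′ , there δ′∈ , δ′≤d

module _ {n : ℕ} where

  row : Fin n → ℕ → Label n → List ℕ
  row v δ lt = map (λ (_ , δ′) → δ + δ′) (filter (λ (v′ , _) → v ≟ v′) lt)

  ∈-commonHubSums⁺ : ∀ {h α β} {ls lt : Label n} → (h , α) ∈ ls → (h , β) ∈ lt → α + β ∈ commonHubSums ls lt
  ∈-commonHubSums⁺ {h} {α} {ls = _ ∷ ls} {lt} (here refl) h∈ =
    ∈-++⁺ˡ (∈-map⁺ (λ (_ , δ′) → α + δ′) (∈-filter⁺ (λ (v′ , _) → h ≟ v′) h∈ refl))
  ∈-commonHubSums⁺ {ls = (v , δ) ∷ ls} {lt} (there h∈) h∈′ =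
    ∈-++⁺ʳ (row v δ lt) (∈-commonHubSums⁺ h∈ h∈′)

  ∈-commonHubSums⁻ : ∀ {δ} (ls lt : Label n) → δ ∈ commonHubSums ls lt →
    ∃ λ h → ∃ λ α → ∃ λ β → (h , α) ∈ ls × (h , β) ∈ lt × δ ≡ α + β
  ∈-commonHubSums⁻ ((v , α) ∷ ls) lt δ∈ with ∈-++⁻ (row v α lt) δ∈
  ... | inj₂ δ∈ls = let h , α , β , h∈ , h∈′ , eq = ∈-commonHubSums⁻ ls lt δ∈ls in
                    h , α , β , there h∈ , h∈′ , eq
  ... | inj₁ δ∈row with ∈-map⁻ (λ (_ , δ′) → α + δ′) δ∈row
  ...   | (_ , β) , p , refl with ∈-filter⁻ (λ (v′ , _) → v ≟ v′) {xs = lt} p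
  ...     | h∈ , refl = v , α , β , here refl , h∈ , refl

  query≤ : ∀ {s t h α β} {L : Index n} → (h , α) ∈ L s → (h , β) ∈ L t → query s t L ≤⁺ [ α + β ]
  query≤ p q = minimum≤ (∈-commonHubSums⁺ p q)

  query-hub : ∀ {s t d} {L : Index n} → query s t L ≤⁺ [ d ] →
    ∃ λ h → ∃ λ α → ∃ λ β → (h , α) ∈ L s × (h , β) ∈ L t × α + β ≤ d
  query-hub {s} {t} {L = L} le with minimum-attained _ le
  ... | _ , δ∈ , δ≤d with ∈-commonHubSums⁻ (L s) (L t) δ∈
  ...   | h , α , β , p , q , refl = h , α , β , p , q , δ≤d

  row-none : ∀ {v δ} {lt : Label n} → All (λ p → v ≢ proj₁ p) lt → row v δ lt ≡ []
  row-none {v} {δ} v∉ = cong (map (λ (_ , δ′) → δ + δ′)) (filter-none (λ (v′ , _) → v ≟ v′) v∉)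

  commonHubSums-[] : ∀ (ls : Label n) → commonHubSums ls [] ≡ []
  commonHubSums-[] []       = refl
  commonHubSums-[] (_ ∷ ls) = commonHubSums-[] ls

  commonHubSums-drop : ∀ {v e} {ls : Label n} → All (λ p → proj₁ p ≢ v) ls → ∀ lt →
                       commonHubSums ls ((v , e) ∷ lt) ≡ commonHubSums ls lt
  commonHubSums-drop []                              lt = refl
  commonHubSums-drop {ls = (u , d) ∷ _} (u≢v ∷ v∉) lt = cong₂ _++_
    (cong (map (λ (_ , δ′) → d + δ′)) (filter-reject (λ (v′ , _) → u ≟ v′) u≢v))
    (commonHubSums-drop v∉ lt)

module _ {n : ℕ} (σ : Permutation′ n) where

  Ranked< : Fin n × ℕ → Fin n × ℕ → Set
  Ranked< p q = σ ⟨$⟩ˡ proj₁ p Fin.< σ ⟨$⟩ˡ proj₁ q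

  rank-injective : ∀ {u v} → σ ⟨$⟩ˡ u ≡ σ ⟨$⟩ˡ v → u ≡ v
  rank-injective eq = trans (sym (inverseʳ σ)) (trans (cong (σ ⟨$⟩ʳ_) eq) (inverseʳ σ))

  <⇒hub≢ : ∀ {u v} → σ ⟨$⟩ˡ u Fin.< σ ⟨$⟩ˡ v → u ≢ v
  <⇒hub≢ lt refl = Fin.<-irrefl refl lt

  -- In sorted labels the smaller of two different head hubs cannot occur in the other label, so
  -- dropping it loses no sum. If the heads agree, their hub occurs nowhere else and gives exactly
  -- one sum.
  merge-query : ∀ {ls lt} → AllPairs Ranked< ls → AllPairs Ranked< lt →
                proj₁ (merge σ ls lt) ≡ minimum (commonHubSums ls lt)
  merge-query {[]}     _ _ = refl
  merge-query {_ ∷ ls} {[]} _ _ = sym (cong minimum (commonHubSums-[] ls))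
  merge-query {(u , d) ∷ ls} {(v , e) ∷ lt} (u< ∷ sls) (v< ∷ slt) =
    by-ranks (merge-query sls (v< ∷ slt)) (merge-query (u< ∷ sls) slt) (merge-query sls slt)
    where
    by-ranks : proj₁ (merge σ ls ((v , e) ∷ lt)) ≡ minimum (commonHubSums ls ((v , e) ∷ lt)) →
              proj₁ (merge σ ((u , d) ∷ ls) lt) ≡ minimum (commonHubSums ((u , d) ∷ ls) lt) →
              proj₁ (merge σ ls lt) ≡ minimum (commonHubSums ls lt) →
              proj₁ (merge σ ((u , d) ∷ ls) ((v , e) ∷ lt)) ≡
              minimum (commonHubSums ((u , d) ∷ ls) ((v , e) ∷ lt))
    by-ranks ih-u ih-v ih
      -- The `does` of the comparison in `merge` reduces to `<ᵇ` on ranks, so abstracting this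
      -- Boolean makes `merge` compute.
      with toℕ (σ ⟨$⟩ˡ u) <ᵇ toℕ (σ ⟨$⟩ˡ v) | <ᵇ-reflects-< (toℕ (σ ⟨$⟩ˡ u)) (toℕ (σ ⟨$⟩ˡ v))
    ... | true | ofʸ u<v = trans ih-u
          (cong (λ r → minimum (r ++ commonHubSums ls ((v , e) ∷ lt))) (sym (row-none
            (<⇒hub≢ u<v ∷ All.map (λ v<w → <⇒hub≢ (Fin.<-trans u<v v<w)) v<))))
    ... | false | ofⁿ u≮v with toℕ (σ ⟨$⟩ˡ v) <ᵇ toℕ (σ ⟨$⟩ˡ u) | <ᵇ-reflects-< (toℕ (σ ⟨$⟩ˡ v)) (toℕ (σ ⟨$⟩ˡ u))
    ...   | true | ofʸ v<u = trans ih-v (cong minimum (sym (commonHubSums-drop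
            ((<⇒hub≢ v<u ∘ sym) ∷ All.map (λ u<w → <⇒hub≢ (Fin.<-trans v<u u<w) ∘ sym) u<) lt)))
    ...   | false | ofⁿ v≮u with rank-injective (Fin.toℕ-injective (≤-antisym (≮⇒≥ v≮u) (≮⇒≥ u≮v)))
    ...     | refl = trans (cong ([ d + e ] ⊓∞_) ih) (cong minimum (sym (cong₂ _++_
              (cong (map (λ (_ , δ′) → d + δ′)) (trans (filter-accept (λ (v′ , _) → u ≟ v′) refl)
                (cong (_ ∷_) (filter-none (λ (v′ , _) → u ≟ v′) (All.map <⇒hub≢ v<)))))
              (commonHubSums-drop (All.map (λ u<w → <⇒hub≢ u<w ∘ sym) u<) lt))))

  merge-time : ∀ ls lt → proj₂ (merge σ ls lt) ≤ 1 + (length ls + length lt)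
  merge-time []       lt = s≤s z≤n
  merge-time (_ ∷ ls) [] = s≤s z≤n
  merge-time ((u , d) ∷ ls) ((v , e) ∷ lt) =
    by-ranks (merge-time ls ((v , e) ∷ lt)) (merge-time ((u , d) ∷ ls) lt) (merge-time ls lt)
    where
    bound : ℕ
    bound = length ls + suc (length lt)
    by-ranks : proj₂ (merge σ ls ((v , e) ∷ lt)) ≤ suc bound →
              proj₂ (merge σ ((u , d) ∷ ls) lt) ≤ suc (suc (length ls + length lt)) →
              proj₂ (merge σ ls lt) ≤ suc (length ls + length lt) →
              proj₂ (merge σ ((u , d) ∷ ls) ((v , e) ∷ lt)) ≤ suc (suc bound)
    by-ranks ih-u ih-v ih with toℕ (σ ⟨$⟩ˡ u) <ᵇ toℕ (σ ⟨$⟩ˡ v)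
    ... | true = s≤s ih-u
    ... | false with toℕ (σ ⟨$⟩ˡ v) <ᵇ toℕ (σ ⟨$⟩ˡ u)
    ...   | true  = s≤s (≤-trans ih-v (s≤s (≤-reflexive (sym (+-suc (length ls) _)))))
    ...   | false = s≤s (≤-trans ih (s≤s (+-monoʳ-≤ (length ls) (n≤1+n _))))

-- One pruned search

module Search {n : ℕ} (G : Graph n) (L : Index n) (r : Fin n) where
  open PrunedBFS G L r

  record Visits (d : ℕ) (ws : List (Fin n)) (s s′ : State n) : Set where
    field
      new     : List (Fin n)
      unique  : Unique new
      index≡  : index s′ ≡ index s
      queue≡  : queue s′ ≡ queue s ++ new
      kept    : ∀ {u e} → P s u ≡ [ e ] → P s′ u ≡ [ e ]
      fresh   : ∀ {u} → u ∈ new → P s u ≡ ∞ × P s′ u ≡ [ suc d ] × u ∈ ws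
      covered : ∀ {u e} → P s′ u ≡ [ e ] → P s u ≡ [ e ] ⊎ u ∈ new
      reached : ∀ {w} → w ∈ ws → ∃ λ e → P s′ w ≡ [ e ]
      time≡   : time s′ ≡ 3 * length new + length ws + time s

  visits : ∀ d ws s → Visits d ws s (foldl (visit d) s ws)
  visits d [] s = record
    { new = [] ; unique = [] ; index≡ = refl ; queue≡ = sym (++-identityʳ (queue s)) ; kept = id
    ; fresh = λ () ; covered = inj₁ ; reached = λ () ; time≡ = refl }
  visits d (w ∷ ws) (state I P Q τ) with P w in eq
  ... | [ e ] = record
    { new     = V.new
    ; unique  = V.unique
    ; index≡  = V.index≡
    ; queue≡  = V.queue≡
    ; kept    = V.kept
    ; fresh   = λ u∈ → let p , q , i = V.fresh u∈ in p , q , there i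
    ; covered = V.covered
    ; reached = λ { (here refl) → e , V.kept eq ; (there i) → V.reached i }
    ; time≡   = trans V.time≡ (shift (3 * length V.new) (length ws) τ)
    }
    where
    module V = Visits (visits d ws (state I P Q (1 + τ)))
    shift : ∀ a b c → a + b + suc c ≡ a + suc b + c
    shift = solve-∀
  ... | ∞ = record
    { new     = w ∷ V.new
    ; unique  = All.tabulate (λ { i refl → contradiction (trans (sym P₁w) (proj₁ (V.fresh i))) λ () }) ∷ V.unique
    ; index≡  = V.index≡
    ; queue≡  = trans V.queue≡ (++-assoc Q (w ∷ []) V.new)
    ; kept    = λ Pu → V.kept (trans (other (λ { refl → contradiction (trans (sym eq) Pu) λ () })) Pu)
    ; fresh   = fresh
    ; covered = covered
    ; reached = λ { (here refl) → suc d , V.kept P₁w ; (there i) → V.reached i }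
    ; time≡   = trans V.time≡ (shift (length V.new) (length ws) τ)
    }
    where
    P₁ : Fin n → ℕ∞
    P₁ = updateAt P w (const [ suc d ])
    module V = Visits (visits d ws (state I P₁ (Q ∷ʳ w) (4 + τ)))
    shift : ∀ a b c → 3 * a + b + (4 + c) ≡ 3 * suc a + suc b + c
    shift = solve-∀
    P₁w : P₁ w ≡ [ suc d ]
    P₁w = updateAt-updates w P
    other : ∀ {u} → u ≢ w → P₁ u ≡ P u
    other u≢w = updateAt-minimal _ w P u≢w
    fresh : ∀ {u} → u ∈ w ∷ V.new → P u ≡ ∞ × _ × u ∈ w ∷ ws
    fresh (here refl) = eq , V.kept P₁w , here refl
    fresh (there i)   = let p , q , j = V.fresh i in
      trans (sym (other λ { refl → contradiction (trans (sym P₁w) p) λ () })) p , q , there j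
    covered : ∀ {u e} → _ ≡ [ e ] → P u ≡ [ e ] ⊎ u ∈ w ∷ V.new
    covered {u} Pu with u ≟ w | V.covered Pu
    ... | yes refl | _       = inj₂ (here refl)
    ... | no _     | inj₂ i  = inj₂ (there i)
    ... | no u≢w   | inj₁ Pu = inj₁ (trans (sym (other u≢w)) Pu)

  -- The classical queue invariant of breadth-first search. `bound` covers all visited vertices, so
  -- that a neighbour found before `u` is expanded is also known to be at most one step deeper than
  -- `u`.
  record TwoLevel (P : Fin n → ℕ∞) (Q : List (Fin n)) : Set where
    field
      depth    : ℕ
      near far : List (Fin n)
      split    : Q ≡ near ++ far
      at-near  : All (λ u → P u ≡ [ depth ]) near
      at-far   : All (λ u → P u ≡ [ suc depth ]) far
      bound    : ∀ {u e} → P u ≡ [ e ] → e ≤ suc depth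

  record Front (P : Fin n → ℕ∞) (u : Fin n) (Q : List (Fin n)) : Set where
    field
      depth    : ℕ
      near far : List (Fin n)
      split    : Q ≡ near ++ far
      at-front : P u ≡ [ depth ]
      at-near  : All (λ u → P u ≡ [ depth ]) near
      at-far   : All (λ u → P u ≡ [ suc depth ]) far
      bound    : ∀ {u e} → P u ≡ [ e ] → e ≤ suc depth

  -- If `near` is empty, the first vertex of `far` opens the next depth and the rest of `far`
  -- becomes the near part.
  front : ∀ {P u Q} → TwoLevel P (u ∷ Q) → Front P u Q
  front record { depth = d ; near = [] ; far = _ ∷ far ; split = refl ; at-far = a ∷ as ; bound = b } =
    record { depth = suc d ; near = far ; far = [] ; split = sym (++-identityʳ far) ; at-front = a
           ; at-near = as ; at-far = [] ; bound = λ eq → m≤n⇒m≤1+n (b eq) }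
  front record { depth = d ; near = _ ∷ near ; far = far ; split = refl ; at-near = a ∷ as ; at-far = f ; bound = b } =
    record { depth = d ; near = near ; far = far ; split = refl ; at-front = a
           ; at-near = as ; at-far = f ; bound = b }

  -- The 6 consists of three operations for the first visit, one for dequeuing and at most two
  -- besides reading the label. While a vertex is queued, only the first three are accounted for, by
  -- `3 * length (queue s)` in `elapsed`.
  degree cost : Fin n → ℕ
  degree u = length (N G u)
  cost   u = 6 + length (L u)

  -- `X` holds the expanded and `Y` the pruned vertices; together with the queue they make up the
  -- visited ones. `parent` is the search tree: its inner vertices are expanded ones.
  record Invariant (s : State n) : Set where
    field
      X Y       : List (Fin n)
      X-unique  : Unique X
      Y-unique  : Unique Y
      Q-unique  : Unique (queue s)
      Y∩X       : ∀ {u} → u ∈ Y → u ∉ X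
      Q∩X       : ∀ {u} → u ∈ queue s → u ∉ X
      Q∩Y       : ∀ {u} → u ∈ queue s → u ∉ Y
      seen      : ∀ {u e} → P s u ≡ [ e ] → u ∈ X ⊎ u ∈ Y ⊎ u ∈ queue s
      root      : P s r ≡ [ 0 ]
      expanded  : ∀ {u} → u ∈ X → ∃ λ d → P s u ≡ [ d ] × index s u ≡ L u ∷ʳ (r , d) ×
                    ¬ query r u L ≤⁺ [ d ] × (∀ {w} → Adj G u w → ∃ λ e → P s w ≡ [ e ] × e ≤ suc d)
      pruned    : ∀ {u} → u ∈ Y → ∃ λ d → P s u ≡ [ d ] × query r u L ≤⁺ [ d ]
      unchanged : ∀ {u} → u ∉ X → index s u ≡ L u
      parent    : ∀ {u d} → P s u ≡ [ d ] →
                    (u ≡ r × d ≡ 0) ⊎ (∃ λ y → ∃ λ d′ → y ∈ X × Adj G y u × P s y ≡ [ d′ ] × d ≡ suc d′)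
      levels    : TwoLevel (P s) (queue s)
      elapsed   : time s ≤ total (λ u → cost u + degree u) X + total cost Y + 3 * length (queue s)
                           + (3 + 2 * length (L r))

  initial : Invariant start
  initial = record
    { X = [] ; Y = [] ; X-unique = [] ; Y-unique = [] ; Q-unique = [] ∷ []
    ; Y∩X = λ () ; Q∩X = λ _ () ; Q∩Y = λ _ ()
    ; seen = λ Pu → inj₂ (inj₂ (here (proj₁ (only Pu)))) ; root = P₀r
    ; expanded = λ () ; pruned = λ () ; unchanged = λ _ → refl
    ; parent = λ Pu → inj₁ (only Pu)
    ; levels = record { depth = 0 ; near = r ∷ [] ; far = [] ; split = refl ; at-near = P₀r ∷ [] ; at-far = []
                      ; bound = λ Pu → subst (_≤ 1) (sym (proj₂ (only Pu))) z≤n }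
    ; elapsed = m≤n+m _ 3
    }
    where
    P₀r : P start r ≡ [ 0 ]
    P₀r = updateAt-updates r (const ∞)
    only : ∀ {u e} → P start u ≡ [ e ] → u ≡ r × e ≡ 0
    only {u} Pu with u ≟ r
    ... | yes refl with refl ← trans (sym Pu) P₀r = refl , refl
    ... | no u≢r with () ← trans (sym Pu) (updateAt-minimal u r (const ∞) u≢r)

  process-cases : ∀ u d I P Q τ → P u ≡ [ d ] →
    (query r u L ≤⁺ [ d ] × process u (state I P Q τ) ≡ state I P Q (1 + length (L u) + τ)) ⊎
    (¬ query r u L ≤⁺ [ d ] × process u (state I P Q τ) ≡
       foldl (visit d) (state (updateAt I u (_∷ʳ (r , d))) P Q (2 + length (L u) + τ)) (N G u))
  process-cases u d I P Q τ eq rewrite eq with query r u L ≤∞? [ d ]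
  ... | yes p = inj₁ (p , refl)
  ... | no ¬p = inj₂ (¬p , refl)

  step-invariant : ∀ s → Invariant s → Invariant (step s)
  step-invariant (state I P [] τ) inv = inv
  step-invariant (state I P (u ∷ Q) τ) inv
    with process-cases u (Front.depth (front (Invariant.levels inv))) I P Q (1 + τ)
           (Front.at-front (front (Invariant.levels inv)))
  ... | inj₁ (below , eq) = subst Invariant (sym eq) (record
    { X = X ; Y = u ∷ Y ; X-unique = X-unique
    ; Y-unique = All.¬Any⇒All¬ Y (Q∩Y (here refl)) ∷ Y-unique
    ; Q-unique = AllPairs.tail Q-unique
    ; Y∩X = λ { (here refl) → Q∩X (here refl) ; (there i) → Y∩X i }
    ; Q∩X = Q∩X ∘ there
    ; Q∩Y = λ { i (here refl) → All.lookup u∉Q i refl ; i (there j) → Q∩Y (there i) j }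
    ; seen = seen′ ∘ seen
    ; root = root
    ; expanded = expanded
    ; pruned = λ { (here refl) → F.depth , F.at-front , below ; (there i) → pruned i }
    ; unchanged = unchanged
    ; parent = parent
    ; levels = record { depth = F.depth ; near = F.near ; far = F.far ; split = F.split
                      ; at-near = F.at-near ; at-far = F.at-far ; bound = F.bound }
    -- A pruned vertex takes one operation less than `cost` allows; this is the added 1.
    ; elapsed = ≤-trans (+-monoʳ-≤ (1 + length (L u)) (s≤s elapsed))
        (≤-trans (m≤m+n _ 1) (≤-reflexive (account (length (L u)) (total (λ u → cost u + degree u) X) (total cost Y) (length Q) _)))
    })
    where
    open Invariant inv
    module F = Front (front levels)
    u∉Q : All (u ≢_) Q
    u∉Q = AllPairs.head Q-unique
    seen′ : ∀ {v} → v ∈ X ⊎ v ∈ Y ⊎ v ∈ u ∷ Q → v ∈ X ⊎ v ∈ u ∷ Y ⊎ v ∈ Q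
    seen′ (inj₁ i)                   = inj₁ i
    seen′ (inj₂ (inj₁ i))            = inj₂ (inj₁ (there i))
    seen′ (inj₂ (inj₂ (here refl)))  = inj₂ (inj₁ (here refl))
    seen′ (inj₂ (inj₂ (there i)))    = inj₂ (inj₂ i)
    account : ∀ l x y q b → 1 + l + suc (x + y + 3 * suc q + b) + 1 ≡ x + (6 + l + y) + 3 * q + b
    account = solve-∀
  ... | inj₂ (above , eq) = subst Invariant (sym eq) (record
    { X = u ∷ X ; Y = Y
    ; X-unique = All.¬Any⇒All¬ X (Q∩X (here refl)) ∷ X-unique
    ; Y-unique = Y-unique
    ; Q-unique = subst Unique (sym V.queue≡) (Unique.++⁺ (AllPairs.tail Q-unique) V.unique
        λ (i , j) → in-queue (there i) (V.fresh j))
    ; Y∩X = λ { i (here refl) → Q∩Y (here refl) i ; i (there j) → Y∩X i j }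
    ; Q∩X = λ i → Q∩X′ (∈-++⁻ Q (subst (_ ∈_) V.queue≡ i))
    ; Q∩Y = λ i → Q∩Y′ (∈-++⁻ Q (subst (_ ∈_) V.queue≡ i))
    ; seen = λ Pv → seen′ (V.covered Pv)
    ; root = V.kept root
    ; expanded = expanded′
    ; pruned = λ i → let d , Pd , le = pruned i in d , V.kept Pd , le
    ; unchanged = λ {v} v∉ → trans (index-other (v∉ ∘ here)) (unchanged (v∉ ∘ there))
    ; parent = λ Pv → parent′ Pv (V.covered Pv)
    ; levels = record
        { depth = F.depth ; near = F.near ; far = F.far ++ V.new
        ; split = trans V.queue≡ (trans (cong (_++ V.new) F.split) (++-assoc F.near F.far V.new))
        ; at-near = All.map V.kept F.at-near
        ; at-far = All.++⁺ (All.map V.kept F.at-far) (All.tabulate λ i → proj₁ (proj₂ (V.fresh i)))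
        ; bound = λ Pv → bound′ Pv (V.covered Pv) }
    ; elapsed = elapsed′
    })
    where
    open Invariant inv
    module F = Front (front levels)
    s₀ s′ : State n
    s₀ = state (updateAt I u (_∷ʳ (r , F.depth))) P Q (2 + length (L u) + (1 + τ))
    s′ = foldl (visit F.depth) s₀ (N G u)
    module V = Visits (visits F.depth (N G u) s₀)
    P′ : Fin n → ℕ∞
    P′ = State.P s′
    u∉Q : All (u ≢_) Q
    u∉Q = AllPairs.head Q-unique
    not-fresh : ∀ {v e} {A : Set} → P v ≡ [ e ] → P v ≡ ∞ × A → ⊥
    not-fresh Pv (Pv∞ , _) with () ← trans (sym Pv) Pv∞
    queue-value : ∀ {v} → v ∈ u ∷ Q → ∃ λ e → P v ≡ [ e ]
    queue-value (here refl) = _ , F.at-front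
    queue-value (there i) with ∈-++⁻ F.near (subst (_ ∈_) F.split i)
    ... | inj₁ j = _ , All.lookup F.at-near j
    ... | inj₂ j = _ , All.lookup F.at-far j
    in-queue : ∀ {v} {A : Set} → v ∈ u ∷ Q → P v ≡ ∞ × A → ⊥
    in-queue i = not-fresh (proj₂ (queue-value i))
    index-other : ∀ {v} → v ≢ u → index s′ v ≡ I v
    index-other v≢u = trans (cong (λ f → f _) V.index≡) (updateAt-minimal _ u I v≢u)
    Q∩X′ : ∀ {v} → v ∈ Q ⊎ v ∈ V.new → v ∉ u ∷ X
    Q∩X′ (inj₁ i) (here refl) = All.lookup u∉Q i refl
    Q∩X′ (inj₁ i) (there j)   = Q∩X (there i) j
    Q∩X′ (inj₂ i) (here refl) = in-queue (here refl) (V.fresh i)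
    Q∩X′ (inj₂ i) (there j)   = not-fresh (proj₁ (proj₂ (expanded j))) (V.fresh i)
    Q∩Y′ : ∀ {v} → v ∈ Q ⊎ v ∈ V.new → v ∉ Y
    Q∩Y′ (inj₁ i) j = Q∩Y (there i) j
    Q∩Y′ (inj₂ i) j = not-fresh (proj₁ (proj₂ (pruned j))) (V.fresh i)
    queued : ∀ {v} → v ∈ Q ⊎ v ∈ V.new → v ∈ queue s′
    queued (inj₁ i) = subst (_ ∈_) (sym V.queue≡) (∈-++⁺ˡ i)
    queued (inj₂ i) = subst (_ ∈_) (sym V.queue≡) (∈-++⁺ʳ Q i)
    seen′ : ∀ {v e} → P v ≡ [ e ] ⊎ v ∈ V.new → v ∈ u ∷ X ⊎ v ∈ Y ⊎ v ∈ queue s′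
    seen′ (inj₂ i) = inj₂ (inj₂ (queued (inj₂ i)))
    seen′ (inj₁ Pv) with seen Pv
    ... | inj₁ i                  = inj₁ (there i)
    ... | inj₂ (inj₁ i)           = inj₂ (inj₁ i)
    ... | inj₂ (inj₂ (here refl)) = inj₁ (here refl)
    ... | inj₂ (inj₂ (there i))   = inj₂ (inj₂ (queued (inj₁ i)))
    bound′ : ∀ {v e} → P′ v ≡ [ e ] → P v ≡ [ e ] ⊎ v ∈ V.new → e ≤ suc F.depth
    bound′ _  (inj₁ Pv) = F.bound Pv
    bound′ Pv (inj₂ i) with refl ← trans (sym Pv) (proj₁ (proj₂ (V.fresh i))) = ≤-refl
    expanded′ : ∀ {v} → v ∈ u ∷ X → ∃ λ d → P′ v ≡ [ d ] × index s′ v ≡ L v ∷ʳ (r , d) ×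
                    ¬ query r v L ≤⁺ [ d ] × (∀ {w} → Adj G v w → ∃ λ e → P′ w ≡ [ e ] × e ≤ suc d)
    expanded′ (here refl) = F.depth , V.kept F.at-front ,
      trans (cong (λ f → f u) V.index≡) (trans (updateAt-updates u I) (cong (_∷ʳ (r , F.depth)) (unchanged (Q∩X (here refl))))) ,
      above , λ uw → let e , Pw = V.reached uw in e , Pw , bound′ Pw (V.covered Pw)
    expanded′ (there i) = let d , Pd , eq , q , nb = expanded i in
      d , V.kept Pd , trans (index-other λ { refl → Q∩X (here refl) i }) eq , q ,
      λ vw → let e , Pw , le = nb vw in e , V.kept Pw , le
    parent′ : ∀ {v d} → P′ v ≡ [ d ] → P v ≡ [ d ] ⊎ v ∈ V.new →
              (v ≡ r × d ≡ 0) ⊎ (∃ λ y → ∃ λ d′ → y ∈ u ∷ X × Adj G y v × P′ y ≡ [ d′ ] × d ≡ suc d′)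
    parent′ _ (inj₁ Pv) with parent Pv
    ... | inj₁ at-root = inj₁ at-root
    ... | inj₂ (y , d′ , i , yv , Py , d≡) = inj₂ (y , d′ , there i , yv , V.kept Py , d≡)
    parent′ Pv (inj₂ i) with V.fresh i
    ... | _ , Pv′ , uv with refl ← trans (sym Pv) Pv′ =
      inj₂ (u , F.depth , here refl , uv , V.kept F.at-front , refl)
    account : ∀ k l g x y q b → 3 * k + g + (2 + l + (1 + (x + y + 3 * suc q + b))) ≡ (6 + l + g + x) + y + 3 * (q + k) + b
    account = solve-∀
    elapsed′ : time s′ ≤ total (λ u → cost u + degree u) (u ∷ X) + total cost Y + 3 * length (queue s′)
                         + (3 + 2 * length (L r))
    elapsed′ = begin
      time s′ ≡⟨ V.time≡ ⟩
      3 * length V.new + degree u + (2 + length (L u) + (1 + τ))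
        ≤⟨ +-monoʳ-≤ (3 * length V.new + degree u) (+-monoʳ-≤ (2 + length (L u)) (s≤s elapsed)) ⟩
      _ ≡⟨ account (length V.new) (length (L u)) (degree u) (total (λ u → cost u + degree u) X) (total cost Y) (length Q) _ ⟩
      total (λ u → cost u + degree u) (u ∷ X) + total cost Y + 3 * (length Q + length V.new) + (3 + 2 * length (L r))
        ≡⟨ cong (λ q → total (λ u → cost u + degree u) (u ∷ X) + total cost Y + 3 * q + (3 + 2 * length (L r)))
             (sym (trans (cong length V.queue≡) (length-++ Q))) ⟩
      _ ∎
      where open ≤-Reasoning

  iterate-invariant : ∀ k s → Invariant s → Invariant (iterate (step) s k)
  iterate-invariant zero    s inv = inv
  iterate-invariant (suc k) s inv = iterate-invariant k _ (step-invariant s inv)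

  open Invariant (iterate-invariant n start initial) public

  settled : ∀ {u e} → P final u ≡ [ e ] → u ∈ X ⊎ u ∈ Y
  settled Pu with seen Pu
  ... | inj₁ i        = inj₁ i
  ... | inj₂ (inj₁ i) = inj₂ i
  ... | inj₂ (inj₂ i) with () ← subst (_ ∈_) queue-exhausted i

  duration : time final ≤ total (λ u → cost u + degree u) X + total cost Y + (3 + 2 * length (L r))
  duration = ≤-trans elapsed (≤-reflexive (cong (_+ (3 + 2 * length (L r)))
    (trans (cong (λ q → total (λ u → cost u + degree u) X + total cost Y + 3 * length q) queue-exhausted)
           (+-identityʳ _))))

  -- Parents are expanded themselves and have a `P`-value smaller by one, so following them back
  -- ends at the root.
  expanded-route : ∀ d {u} → u ∈ X → P final u ≡ [ d ] → Route G (_∈ X) r u d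
  expanded-route d u∈ Pu with parent Pu
  ... | inj₁ (refl , refl) = stay u∈
  ... | inj₂ (y , d′ , y∈ , yu , Py , refl) = extend (expanded-route d′ y∈ Py) yu u∈

  -- The route is followed up to its first pruned vertex. Before that all its vertices are expanded,
  -- and by `expanded` their `P`-values do not exceed the length walked. From a pruned vertex `p`
  -- on, the value `c` stands for the part already walked.
  covers : ∀ {u a} → Route G (const ⊤) r u a →
    (u ∈ X × ∃ λ δ → P final u ≡ [ δ ] × δ ≤ a) ⊎
    (∃ λ p → ∃ λ b → ∃ λ c → query r p L ≤⁺ [ c ] × Route G (const ⊤) p u b × c + b ≤ a)
  covers (stay _) with settled root
  ... | inj₁ i = inj₁ (i , 0 , root , z≤n)
  ... | inj₂ i with pruned i
  ...   | c , Pr , le with refl ← trans (sym Pr) root = inj₂ (r , 0 , 0 , le , stay tt , z≤n)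
  covers {u} (extend ρ yu _) with covers ρ
  ... | inj₂ (p , b , c , le , π , c+b≤) =
    inj₂ (p , suc b , c , le , extend π yu tt , ≤-trans (≤-reflexive (+-suc c b)) (s≤s c+b≤))
  ... | inj₁ (y∈ , δ , Py , δ≤) with expanded y∈
  ...   | δ′ , Py′ , _ , _ , nb with nb yu | trans (sym Py) Py′
  ...     | e , Pu , e≤ | refl with settled Pu
  ...       | inj₁ i = inj₁ (i , e , Pu , ≤-trans e≤ (s≤s δ≤))
  ...       | inj₂ i with pruned i
  ...         | c , Pu′ , le with refl ← trans (sym Pu) Pu′ =
                inj₂ (u , 0 , c , le , stay tt , ≤-trans (≤-reflexive (+-identityʳ c)) (≤-trans e≤ (s≤s δ≤)))

-- All searches

module _ {n : ℕ} {G : Graph n} where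

  weaken : ∀ {Q R : Fin n → Set} → (∀ {x} → Q x → R x) → ∀ {u v d} → Route G Q u v d → Route G R u v d
  weaken f (stay q)       = stay (f q)
  weaken f (extend ρ e q) = extend (weaken f ρ) e (f q)

  module _ {Q : Fin n → Set} where

    append : ∀ {u v w a b} → Route G Q u v a → Route G Q v w b → Route G Q u w (b + a)
    append ρ (stay _)       = ρ
    append ρ (extend π e q) = extend (append ρ π) e q

    prepend : ∀ {u v w d} → Q u → Adj G u v → Route G Q v w d → Route G Q u w (suc d)
    prepend q e (stay q′)       = extend (stay q) e q′
    prepend q e (extend ρ e′ q′) = extend (prepend q e ρ) e′ q′

    reverse : ∀ {u v d} → Route G Q u v d → Route G Q v u d
    reverse (stay q)       = stay q
    reverse (extend ρ e q) = prepend q (N-sym G e) (reverse ρ)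

module Labeling {n D : ℕ} (G : Graph n) (σ : Permutation′ n) (κ : Fin n → Fin D) (centred : Centred G κ)
  (ranked : ∀ {u v} → κ u Fin.< κ v → σ ⟨$⟩ˡ u Fin.< σ ⟨$⟩ˡ v) where

  Above : Fin n → Fin n → Set
  Above u x = κ u Fin.≤ κ x

  PlainRoute : Fin n → Fin n → ℕ → Set
  PlainRoute = Route G (const ⊤)

  -- Both routes stay above the common colour of their starts, so on the joined route this colour is
  -- least and occurs at both ends. This bounds the label sizes and the number of searches charged
  -- to a vertex.
  common-end : ∀ {r r′ u d d′} → Route G (Above r) r u d → Route G (Above r′) r′ u d′ → κ r ≡ κ r′ → r ≡ r′
  common-end {r} ρ ρ′ eq =
    centred (append ρ (reverse (weaken (λ {x} → subst (Fin._≤ κ x) (sym eq)) ρ′))) eq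

  charge : Fin n → ℕ
  charge u = 6 + D + length (N G u)

  -- The share of one search that is not charged to pairs in `Z`: the set-up with the label of the
  -- root, and at most `D` pruned vertices of smaller colour.
  overhead : ℕ
  overhead = 3 + 2 * D + D * (6 + D)

  -- `ks` holds the ranks of the roots still to come. `hop` is why pruning is harmless: for every
  -- route through a processed vertex there is a common hub that is no worse. `elapsed` counts the
  -- overhead of the coming searches in advance, so that its right-hand side grows only with `Z`.
  record Progress (ks : List (Fin n)) (L : Index n) (τ : ℕ) : Set where
    field
      -- The pairs (r , u) such that the search from r visited u and κ r ≤ κ u.
      Z        : List (Fin n × Fin n)
      Z-unique : Unique Z
      Z-above  : ∀ {r u} → (r , u) ∈ Z → ∃ (Route G (Above r) r u)
      Z-done   : ∀ {r u} → (r , u) ∈ Z → σ ⟨$⟩ˡ r ∉ ks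
      sound    : ∀ {u h δ} → (h , δ) ∈ L u → Route G (Above h) h u δ
      sorted   : ∀ u → AllPairs (Ranked< σ) (L u)
      done     : ∀ {u h δ} → (h , δ) ∈ L u → σ ⟨$⟩ˡ h ∉ ks
      hop      : ∀ {v s t a b} → σ ⟨$⟩ˡ v ∉ ks → PlainRoute s v a → PlainRoute v t b →
                 ∃ λ h → ∃ λ α → ∃ λ β → (h , α) ∈ L s × (h , β) ∈ L t × α + β ≤ a + b
      elapsed  : τ + length ks * overhead ≤ 3 * n + n * overhead + total (charge ∘ proj₂) Z

    -- By `sound` and `common-end`, different hubs of one label have different colours.
    label-length : ∀ u → length (L u) ≤ D
    label-length u = subst (_≤ D) (length-map proj₁ (L u)) (length-≤-Fin κ hubs-unique same-hub)
      where
      hubs-unique : Unique (map proj₁ (L u))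
      hubs-unique = AllPairs.map⁺ (AllPairs.map (<⇒hub≢ σ) (sorted u))
      hub-route : ∀ {h} → h ∈ map proj₁ (L u) → ∃ (Route G (Above h) h u)
      hub-route h∈ with ∈-map⁻ proj₁ h∈
      ... | _ , p , refl = _ , sound p
      same-hub : ∀ {h h′} → h ∈ map proj₁ (L u) → h′ ∈ map proj₁ (L u) → κ h ≡ κ h′ → h ≡ h′
      same-hub h∈ h′∈ = common-end (proj₂ (hub-route h∈)) (proj₂ (hub-route h′∈))

  Ascending : List (Fin n) → Set
  Ascending ks = AllPairs Fin._<_ ks × (∀ {i j} → i ∉ ks → j ∈ ks → i Fin.< j)

  module Round {k : Fin n} {ks : List (Fin n)} {L : Index n} {τ : ℕ}
    (ascending : Ascending (k ∷ ks)) (progress : Progress (k ∷ ks) L τ) where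

    open Progress progress
    r : Fin n
    r = σ ⟨$⟩ʳ k
    module S = Search G L r
    open S using (X; Y)
    open PrunedBFS G L r using (final)
    P′ : Fin n → ℕ∞
    P′ = P final
    L′ : Index n
    L′ = index final

    rank-r : σ ⟨$⟩ˡ r ≡ k
    rank-r = inverseˡ σ

    k∉ks : k ∉ ks
    k∉ks k∈ with k< ∷ _ ← proj₁ ascending = Fin.<-irrefl refl (All.lookup k< k∈)

    done<k : ∀ {i} → i ∉ k ∷ ks → i Fin.< k
    done<k i∉ = proj₂ ascending i∉ (here refl)

    <k⇒done : ∀ {i} → i Fin.< k → i ∉ k ∷ ks
    <k⇒done i<k (here refl) = Fin.<-irrefl refl i<k
    <k⇒done i<k (there i∈) with k< ∷ _ ← proj₁ ascending = Fin.<-asym i<k (All.lookup k< i∈)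

    Ascending-tail : Ascending ks
    Ascending-tail = AllPairs.tail (proj₁ ascending) , before
      where
      before : ∀ {i j} → i ∉ ks → j ∈ ks → i Fin.< j
      before {i} i∉ j∈ with i ≟ k | proj₁ ascending
      ... | yes refl | k< ∷ _ = All.lookup k< j∈
      ... | no i≢k   | _ = proj₂ ascending (λ { (here eq) → i≢k eq ; (there i∈) → i∉ i∈ }) (there j∈)

    -- A vertex u of smaller colour precedes r, so hop makes the search prune at u.
    X⊆Above : ∀ {u} → u ∈ X → Above r u
    X⊆Above {u} u∈ with S.expanded u∈
    ... | d , Pu , _ , unpruned , _ = ≮⇒≥ λ u<r →
      let i∉ = <k⇒done (subst (σ ⟨$⟩ˡ u Fin.<_) rank-r (ranked u<r))
          h , α , β , p , q , le = hop i∉ (weaken _ (S.expanded-route d u∈ Pu)) (stay tt)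
      in unpruned (≤⁺-trans ≤-trans (query≤ {s = r} {t = u} {L = L} p q)
                            [ ≤-trans le (≤-reflexive (+-identityʳ d)) ])

    -- The last vertex may be pruned rather than expanded, hence the separate hypothesis `Q u`.
    visited-route : ∀ {Q : Fin n → Set} {u d} → (∀ {x} → x ∈ X → Q x) → Q u → P′ u ≡ [ d ] → Route G Q r u d
    visited-route X⊆Q q Pu with S.parent Pu
    ... | inj₁ (refl , refl) = stay q
    ... | inj₂ (y , d′ , y∈ , yu , Py , refl) = extend (weaken X⊆Q (S.expanded-route d′ y∈ Py)) yu q

    L⊆L′ : ∀ {u p} → p ∈ L u → p ∈ L′ u
    L⊆L′ {u} {p} p∈ with u ∈? X
    ... | no u∉  = subst (p ∈_) (sym (S.unchanged u∉)) p∈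
    ... | yes u∈ with S.expanded u∈
    ...   | _ , _ , eq , _ = subst (p ∈_) (sym eq) (∈-++⁺ˡ p∈)

    ∈L′ : ∀ {u h δ} → (h , δ) ∈ L′ u → (h , δ) ∈ L u ⊎ (h ≡ r × u ∈ X × P′ u ≡ [ δ ])
    ∈L′ {u} p∈ with u ∈? X
    ... | no u∉  = inj₁ (subst (_ ∈_) (S.unchanged u∉) p∈)
    ... | yes u∈ with S.expanded u∈
    ...   | _ , Pu , eq , _ with ∈-++⁻ (L u) (subst (_ ∈_) eq p∈)
    ...     | inj₁ p∈L         = inj₁ p∈L
    ...     | inj₂ (here refl) = inj₂ (refl , u∈ , Pu)

    new-entry : ∀ {u δ} → u ∈ X → P′ u ≡ [ δ ] → (r , δ) ∈ L′ u
    new-entry {u} u∈ Pu with S.expanded u∈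
    ... | _ , Pu′ , eq , _ with refl ← trans (sym Pu) Pu′ = subst (_ ∈_) (sym eq) (∈-++⁺ʳ (L u) (here refl))

    sound′ : ∀ {u h δ} → (h , δ) ∈ L′ u → Route G (Above h) h u δ
    sound′ p∈ with ∈L′ p∈
    ... | inj₁ p∈L = sound p∈L
    ... | inj₂ (refl , u∈ , Pu) = weaken X⊆Above (S.expanded-route _ u∈ Pu)

    ∉-tail : ∀ {i} → i ∉ k ∷ ks → i ∉ ks
    ∉-tail i∉ = i∉ ∘ there

    rank-r∉ks : σ ⟨$⟩ˡ r ∉ ks
    rank-r∉ks = subst (_∉ ks) (sym rank-r) k∉ks

    done′ : ∀ {u h δ} → (h , δ) ∈ L′ u → σ ⟨$⟩ˡ h ∉ ks
    done′ p∈ with ∈L′ p∈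
    ... | inj₁ p∈L = ∉-tail (done p∈L)
    ... | inj₂ (refl , _) = rank-r∉ks

    sorted′ : ∀ u → AllPairs (Ranked< σ) (L′ u)
    sorted′ u with u ∈? X
    ... | no u∉  = subst (AllPairs (Ranked< σ)) (sym (S.unchanged u∉)) (sorted u)
    ... | yes u∈ with S.expanded u∈
    ...   | _ , _ , eq , _ = subst (AllPairs (Ranked< σ)) (sym eq) (AllPairs.++⁺ (sorted u) ([] ∷ [])
            (All.tabulate λ p∈ → subst (_ Fin.<_) (sym rank-r) (done<k (done p∈)) ∷ []))

    Hop : Index n → Fin n → Fin n → ℕ → Set
    Hop I s t c = ∃ λ h → ∃ λ α → ∃ λ β → (h , α) ∈ I s × (h , β) ∈ I t × α + β ≤ c

    Hop-mono : ∀ {s t c c′} → c ≤ c′ → Hop L s t c → Hop L′ s t c′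
    Hop-mono c≤ (h , α , β , p , q , le) = h , α , β , L⊆L′ p , L⊆L′ q , ≤-trans le c≤

    Hop-sym : ∀ {I s t a b} → Hop I s t (a + b) → Hop I t s (b + a)
    Hop-sym {a = a} {b} (h , α , β , p , q , le) =
      h , β , α , q , p , subst₂ _≤_ (+-comm α β) (+-comm a b) le

    plain : ∀ {Q u v d} → Route G Q u v d → PlainRoute u v d
    plain = weaken (λ _ → tt)

    -- If the search from r is pruned on the way to s, then a hub of the pruned vertex serves
    -- instead of r.
    detour : ∀ {s t a b} → PlainRoute r t b →
      (∃ λ p → ∃ λ b′ → ∃ λ c → query r p L ≤⁺ [ c ] × PlainRoute p s b′ × c + b′ ≤ a) → Hop L′ s t (a + b)
    detour {a = a} {b} ρ (p , b′ , c , le , π , c+b′≤a) with query-hub {s = r} {t = p} {L = L} le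
    ... | h , α , β , hr , hp , α+β≤c = Hop-mono (begin
      (β + b′) + (b + α) ≡⟨ rearrange β b′ b α ⟩
      (α + β) + b′ + b   ≤⟨ +-monoˡ-≤ b (≤-trans (+-monoˡ-≤ b′ α+β≤c) c+b′≤a) ⟩
      a + b              ∎)
      (hop (done hr) (append (reverse π) (reverse (plain (sound hp)))) (append (plain (sound hr)) ρ))
      where
      open ≤-Reasoning
      rearrange : ∀ β b′ b α → (β + b′) + (b + α) ≡ (α + β) + b′ + b
      rearrange = solve-∀

    -- For `v ≡ r`, either the search expands both `s` and `t` at distances no larger than `a` and
    -- `b`, and `r` is the hub, or one of the two halves meets a pruned vertex and `detour` applies
    -- to it.
    hop′ : ∀ {v s t a b} → σ ⟨$⟩ˡ v ∉ ks → PlainRoute s v a → PlainRoute v t b → Hop L′ s t (a + b)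
    hop′ {v} {s} {t} {a} {b} i∉ ρ π with v ≟ r
    ... | no v≢r = Hop-mono ≤-refl (hop
            (λ { (here eq) → v≢r (trans (sym (inverseʳ σ)) (cong (σ ⟨$⟩ʳ_) eq)) ; (there i∈) → i∉ i∈ }) ρ π)
    ... | yes refl with S.covers (reverse ρ) | S.covers π
    ...   | inj₂ cut | _ = detour π cut
    ...   | inj₁ _ | inj₂ cut = Hop-sym {I = L′} {a = b} (detour (reverse ρ) cut)
    ...   | inj₁ (s∈ , α , Ps , α≤a) | inj₁ (t∈ , β , Pt , β≤b) =
            r , α , β , new-entry s∈ Ps , new-entry t∈ Pt , +-mono-≤ α≤a β≤b

    above? : ∀ u → Dec (Above r u)
    above? u = κ r Fin.≤? κ u

    Y↑ Y↓ new : List (Fin n)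
    Y↑  = filter above? Y
    Y↓  = filter (λ u → ¬? (above? u)) Y
    new = X ++ Y↑

    new-unique : Unique new
    new-unique = Unique.++⁺ S.X-unique (Unique.filter⁺ above? S.Y-unique)
      λ (u∈X , u∈Y) → S.Y∩X (proj₁ (∈-filter⁻ above? u∈Y)) u∈X

    new-above : ∀ {u} → u ∈ new → ∃ (Route G (Above r) r u)
    new-above u∈ with ∈-++⁻ X u∈
    ... | inj₁ u∈X = let d , Pu , _ = S.expanded u∈X in d , visited-route X⊆Above (X⊆Above u∈X) Pu
    ... | inj₂ u∈Y =
      let u∈ , r≤u = ∈-filter⁻ above? u∈Y
          d , Pu , _ = S.pruned u∈
      in d , visited-route X⊆Above r≤u Pu

    -- Two of these vertices are joined through `r` by expanded vertices, whose colours are at least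
    -- that of `r` and hence larger than theirs. So if their colours agree, centredness makes them
    -- equal.
    ∣Y↓∣≤D : length Y↓ ≤ D
    ∣Y↓∣≤D = length-≤-Fin κ (Unique.filter⁺ _ S.Y-unique) inj
      where
      inj : ∀ {u v} → u ∈ Y↓ → v ∈ Y↓ → κ u ≡ κ v → u ≡ v
      inj {u} {v} u∈ v∈ eq =
        let u∈Y , r≰u = ∈-filter⁻ (λ u → ¬? (above? u)) u∈
            v∈Y , _   = ∈-filter⁻ (λ u → ¬? (above? u)) v∈
            _ , Pu , _ = S.pruned u∈Y
            _ , Pv , _ = S.pruned v∈Y
            X⊆ : ∀ {x} → x ∈ X → Above u x
            X⊆ x∈ = ≤-trans (≰⇒≥ r≰u) (X⊆Above x∈)
        in centred (append (reverse (visited-route X⊆ ≤-refl Pu))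
                           (visited-route X⊆ (≤-reflexive (cong Fin.toℕ eq)) Pv)) eq

    -- Visits in `X` and `Y↑` are charged to their vertices; `Y↓` and the set-up fit into
    -- `overhead`.
    duration : time final ≤ total charge new + overhead
    duration = begin
      time final
        ≤⟨ S.duration ⟩
      total (λ u → S.cost u + S.degree u) X + total S.cost Y + (3 + 2 * length (L r))
        ≤⟨ +-mono-≤ (+-mono-≤ (total-mono _ charge X λ {u} _ → +-monoˡ-≤ (S.degree u) (+-monoʳ-≤ 6 (label-length u)))
             (total-≤const S.cost (6 + D) Y λ {u} _ → +-monoʳ-≤ 6 (label-length u)))
             (+-monoʳ-≤ 3 (*-monoʳ-≤ 2 (label-length r))) ⟩
      total charge X + length Y * (6 + D) + (3 + 2 * D)
        ≡⟨ cong (λ y → total charge X + y * (6 + D) + (3 + 2 * D)) (length-filter-split above? Y) ⟩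
      total charge X + (length Y↑ + length Y↓) * (6 + D) + (3 + 2 * D)
        ≡⟨ cong (λ y → total charge X + y + (3 + 2 * D)) (*-distribʳ-+ (6 + D) (length Y↑) (length Y↓)) ⟩
      total charge X + (length Y↑ * (6 + D) + length Y↓ * (6 + D)) + (3 + 2 * D)
        ≤⟨ +-monoˡ-≤ (3 + 2 * D) (+-monoʳ-≤ (total charge X) (+-mono-≤
             (≤-trans (≤-reflexive (sym (total-const (6 + D) Y↑))) (total-mono _ charge Y↑ λ _ → m≤m+n (6 + D) _))
             (*-monoˡ-≤ (6 + D) ∣Y↓∣≤D))) ⟩
      total charge X + (total charge Y↑ + D * (6 + D)) + (3 + 2 * D)
        ≡⟨ rearrange (total charge X) (total charge Y↑) (D * (6 + D)) (3 + 2 * D) ⟩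
      total charge X + total charge Y↑ + overhead
        ≡⟨ cong (_+ overhead) (sym (total-++ charge X Y↑)) ⟩
      total charge new + overhead ∎
      where
      open ≤-Reasoning
      rearrange : ∀ x y a b → x + (y + a) + b ≡ x + y + (b + a)
      rearrange = solve-∀

    Z′ : List (Fin n × Fin n)
    Z′ = map (r ,_) new ++ Z

    Z′-cases : ∀ {q u} → (q , u) ∈ Z′ → (q ≡ r × u ∈ new) ⊎ (q , u) ∈ Z
    Z′-cases p with ∈-++⁻ (map (r ,_) new) p
    ... | inj₂ z = inj₂ z
    ... | inj₁ x with ∈-map⁻ (r ,_) x
    ...   | _ , u∈ , refl = inj₁ (refl , u∈)

    elapsed′ : time final + τ + length ks * overhead ≤ 3 * n + n * overhead + total (charge ∘ proj₂) Z′
    elapsed′ = begin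
      time final + τ + length ks * overhead
        ≤⟨ +-monoˡ-≤ (length ks * overhead) (+-monoˡ-≤ τ duration) ⟩
      total charge new + overhead + τ + length ks * overhead
        ≡⟨ rearrange₁ (total charge new) overhead τ (length ks * overhead) ⟩
      total charge new + (τ + suc (length ks) * overhead)
        ≤⟨ +-monoʳ-≤ (total charge new) elapsed ⟩
      total charge new + (3 * n + n * overhead + total (charge ∘ proj₂) Z)
        ≡⟨ rearrange₂ (total charge new) (3 * n + n * overhead) (total (charge ∘ proj₂) Z) ⟩
      3 * n + n * overhead + (total charge new + total (charge ∘ proj₂) Z)
        ≡⟨ cong (λ x → 3 * n + n * overhead + (x + total (charge ∘ proj₂) Z)) (sym (total-map (charge ∘ proj₂) (r ,_) new)) ⟩
      3 * n + n * overhead + (total (charge ∘ proj₂) (map (r ,_) new) + total (charge ∘ proj₂) Z)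
        ≡⟨ cong (3 * n + n * overhead +_) (sym (total-++ (charge ∘ proj₂) (map (r ,_) new) Z)) ⟩
      3 * n + n * overhead + total (charge ∘ proj₂) Z′ ∎
      where
      open ≤-Reasoning
      rearrange₁ : ∀ a b c d → a + b + c + d ≡ a + (c + (b + d))
      rearrange₁ = solve-∀
      rearrange₂ : ∀ a b c → a + (b + c) ≡ b + (a + c)
      rearrange₂ = solve-∀

    progress′ : Progress ks L′ (time final + τ)
    progress′ = record
      { Z        = Z′
      ; Z-unique = Unique.++⁺ (Unique.map⁺ ,-injectiveʳ new-unique) Z-unique disjoint
      ; Z-above  = λ p → above (Z′-cases p)
      ; Z-done   = λ p → doneZ (Z′-cases p)
      ; sound    = sound′
      ; sorted   = sorted′
      ; done     = done′
      ; hop      = hop′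
      ; elapsed  = elapsed′
      }
      where
      disjoint : ∀ {p} → ¬ (p ∈ map (r ,_) new × p ∈ Z)
      disjoint (x , z) with ∈-map⁻ (r ,_) x
      ... | _ , _ , refl = Z-done z (here rank-r)
      above : ∀ {q u} → (q ≡ r × u ∈ new) ⊎ (q , u) ∈ Z → ∃ (Route G (Above q) q u)
      above (inj₁ (refl , u∈)) = new-above u∈
      above (inj₂ z)           = Z-above z
      doneZ : ∀ {q u} → (q ≡ r × u ∈ new) ⊎ (q , u) ∈ Z → σ ⟨$⟩ˡ q ∉ ks
      doneZ (inj₁ (refl , _)) = rank-r∉ks
      doneZ (inj₂ z)          = ∉-tail (Z-done z)

  rounds : ∀ ks {L τ} → Ascending ks → Progress ks L τ →
           let L′ , τ′ = foldl (search G σ) (L , τ) ks in Progress [] L′ τ′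
  rounds []       asc pr = pr
  rounds (k ∷ ks) asc pr = rounds ks (Round.Ascending-tail asc pr) (Round.progress′ asc pr)

  initially : Progress (allFin n) (const []) (3 * n)
  initially = record
    { Z = [] ; Z-unique = [] ; Z-above = λ () ; Z-done = λ () ; sound = λ () ; sorted = λ _ → [] ; done = λ ()
    ; hop = λ {v} i∉ → contradiction (∈-allFin (σ ⟨$⟩ˡ v)) i∉
    ; elapsed = ≤-trans (≤-reflexive (cong (λ l → 3 * n + l * overhead) (length-tabulate {n = n} id))) (m≤m+n _ 0)
    }

  open Progress (rounds (allFin n)
    (AllPairs.tabulate⁺-< id , λ i∉ _ → contradiction (∈-allFin _) i∉) initially) public

  -- Replacing the root by its colour is injective on `Z` by `common-end`, so a vertex is charged at
  -- most once for each of the `D` colours.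
  fibre-total : total (charge ∘ proj₂) Z ≤ D * total charge (allFin n)
  fibre-total = begin
    total (charge ∘ proj₂) Z
      ≡⟨ sym (total-map (charge ∘ proj₂) paint Z) ⟩
    total (charge ∘ proj₂) (map paint Z)
      ≤⟨ total-⊆ (charge ∘ proj₂) (Unique-map paint Z-unique paint-injective)
           (λ {p} _ → ∈-fibres⁺ (const (allFin n)) (∈-allFin (proj₁ p)) (∈-allFin (proj₂ p))) ⟩
    total (charge ∘ proj₂) (fibres (const (allFin n)) (allFin D))
      ≡⟨ total-concatMap (charge ∘ proj₂) _ (allFin D) ⟩
    total (λ i → total (charge ∘ proj₂) (map (i ,_) (allFin n))) (allFin D)
      ≤⟨ total-≤const _ (total charge (allFin n)) (allFin D)
           (λ {i} _ → ≤-reflexive (total-map (charge ∘ proj₂) (i ,_) (allFin n))) ⟩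
    length (allFin D) * total charge (allFin n)
      ≡⟨ cong (_* total charge (allFin n)) (length-tabulate {n = D} id) ⟩
    D * total charge (allFin n) ∎
    where
    open ≤-Reasoning
    paint : Fin n × Fin n → Fin D × Fin n
    paint (r , u) = κ r , u
    paint-injective : ∀ {p q} → p ∈ Z → q ∈ Z → paint p ≡ paint q → p ≡ q
    paint-injective {r , u} {r′ , u′} p q eq with ,-injectiveʳ eq
    ... | refl = cong (_, u) (common-end (proj₂ (Z-above p)) (proj₂ (Z-above q)) (cong proj₁ eq))

  charge-total : total charge (allFin n) ≤ n * (6 + D) + 2 * ∣E∣ G
  charge-total = begin
    total charge (allFin n)
      ≡⟨ total-+ (const (6 + D)) (length ∘ N G) (allFin n) ⟩
    total (const (6 + D)) (allFin n) + total (length ∘ N G) (allFin n)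
      ≤⟨ +-mono-≤ (≤-reflexive (trans (total-const (6 + D) (allFin n)) (cong (_* (6 + D)) (length-tabulate {n = n} id))))
                  (handshake G) ⟩
    n * (6 + D) + 2 * ∣E∣ G ∎
    where open ≤-Reasoning

  preprocessTime≤ : preprocessTime G σ ≤ 3 * n + n * overhead + D * (n * (6 + D) + 2 * ∣E∣ G)
  preprocessTime≤ = ≤-trans (m≤m+n _ 0) (≤-trans elapsed
    (+-monoʳ-≤ (3 * n + n * overhead) (≤-trans fibre-total (*-monoʳ-≤ D charge-total))))

  indexSize≤ : indexSize (pllIndex G σ) ≤ n * D
  indexSize≤ = ≤-trans (total-≤const (length ∘ pllIndex G σ) D (allFin n) (λ {u} _ → label-length u))
    (≤-reflexive (cong (_* D) (length-tabulate {n = n} id)))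

  answer≡query : ∀ s t → answer σ (pllIndex G σ) s t ≡ query s t (pllIndex G σ)
  answer≡query s t = merge-query σ (sorted s) (sorted t)

  answerTime≤ : ∀ s t → answerTime σ (pllIndex G σ) s t ≤ 1 + (D + D)
  answerTime≤ s t = ≤-trans (merge-time σ (pllIndex G σ s) (pllIndex G σ t))
    (s≤s (+-mono-≤ (label-length s) (label-length t)))

-- Numerical bounds

n<2^[1+⌊log₂n⌋] : ∀ n → n < 2 ^ suc ⌊log₂ n ⌋
n<2^[1+⌊log₂n⌋] n = ≰⇒> λ le → <-irrefl refl
  (subst (_≤ ⌊log₂ n ⌋) (⌊log₂[2^n]⌋≡n (suc ⌊log₂ n ⌋)) (⌊log₂⌋-mono-≤ le))

suc≤2*1⊔ : ∀ a → suc a ≤ 2 * (1 ⊔ a)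
suc≤2*1⊔ a = +-mono-≤ (m≤m⊔n 1 a) (≤-trans (m≤n⊔m 1 a) (≤-reflexive (sym (+-identityʳ _))))

colours≤ : ∀ w l → suc l * suc w ≤ 4 * ((1 ⊔ w) * (1 ⊔ l))
colours≤ w l = ≤-trans (*-mono-≤ (suc≤2*1⊔ l) (suc≤2*1⊔ w)) (≤-reflexive (rearrange (1 ⊔ l) (1 ⊔ w)))
  where
  rearrange : ∀ a b → 2 * a * (2 * b) ≡ 4 * (b * a)
  rearrange = solve-∀

-- With D replaced by 4E the left side becomes 6n + 56nE + 32nE² + 8mE. As E is at least 1, the
-- terms in n are at most (6 + 56 + 32)nE², which gives the constant 94.
time-bound : ∀ n m {D E} → D ≤ 4 * E → 1 ≤ E →
  3 * n + n * (3 + 2 * D + D * (6 + D)) + D * (n * (6 + D) + 2 * m) ≤ 94 * (m * E + n * (E * E))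
time-bound n m {D} {suc e} D≤ _ = begin
  3 * n + n * (3 + 2 * D + D * (6 + D)) + D * (n * (6 + D) + 2 * m)
    ≤⟨ +-mono-≤ (+-monoʳ-≤ (3 * n) (*-monoʳ-≤ n (+-mono-≤ (+-monoʳ-≤ 3 (*-monoʳ-≤ 2 D≤)) (*-mono-≤ D≤ (+-monoʳ-≤ 6 D≤)))))
                (*-mono-≤ D≤ (+-monoˡ-≤ (2 * m) (*-monoʳ-≤ n (+-monoʳ-≤ 6 D≤)))) ⟩
  3 * n + n * (3 + 2 * F + F * (6 + F)) + F * (n * (6 + F) + 2 * m)
    -- The exact gap to the final bound; written in `e`, with `E` being `suc e`, it has only
    -- nonnegative coefficients.
    ≤⟨ m≤m+n _ (86 * m * suc e + 68 * n * e + 62 * n * e * e) ⟩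
  3 * n + n * (3 + 2 * F + F * (6 + F)) + F * (n * (6 + F) + 2 * m) + (86 * m * suc e + 68 * n * e + 62 * n * e * e)
    ≡⟨ expand n m e ⟩
  94 * (m * suc e + n * (suc e * suc e)) ∎
  where
  open ≤-Reasoning
  F : ℕ
  F = 4 * suc e
  expand : ∀ n m e →
    3 * n + n * (3 + 2 * (4 * suc e) + 4 * suc e * (6 + 4 * suc e)) + 4 * suc e * (n * (6 + 4 * suc e) + 2 * m)
      + (86 * m * suc e + 68 * n * e + 62 * n * e * e)
    ≡ 94 * (m * suc e + n * (suc e * suc e))
  expand = solve-∀

module Bounds {n : ℕ} (G : Graph n) (T : TreeDecomposition G) where
  -- The maxima with 1 keep the factors positive when the tree-width or the logarithm is 0.
  w′ lg E D : ℕ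
  w′ = 1 ⊔ width T
  lg = 1 ⊔ ⌊log₂ n ⌋
  E  = w′ * lg
  D  = suc ⌊log₂ n ⌋ * suc (width T)

  D≤4E : D ≤ 4 * E
  D≤4E = colours≤ (width T) ⌊log₂ n ⌋

  1≤E : 1 ≤ E
  1≤E = *-mono-≤ (m≤m⊔n 1 (width T)) (m≤m⊔n 1 ⌊log₂ n ⌋)

  open Colouring G T (suc ⌊log₂ n ⌋) (n<2^[1+⌊log₂n⌋] n) using (colour; colour-centred)

  sorting : ∃ λ (σ : Permutation′ n) → ∀ {i j} → i Fin.≤ j → toℕ (colour (σ ⟨$⟩ʳ i)) ≤ toℕ (colour (σ ⟨$⟩ʳ j))
  sorting = sort (toℕ ∘ colour)

  order : Permutation′ n
  order = proj₁ sorting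

  open Labeling G order colour colour-centred (sorted-rank (toℕ ∘ colour) order (proj₂ sorting))
    using (preprocessTime≤; indexSize≤; answer≡query; answerTime≤) public

  preprocessTime-O : preprocessTime G order ≤ 94 * (w′ * ∣E∣ G * lg + w′ ^ 2 * n * lg ^ 2)
  preprocessTime-O = ≤-trans preprocessTime≤ (≤-trans (time-bound n (∣E∣ G) D≤4E 1≤E)
    (*-monoʳ-≤ 94 (≤-reflexive (rearrange w′ lg n (∣E∣ G)))))
    where
    rearrange : ∀ a b n m → m * (a * b) + n * (a * b * (a * b)) ≡ a * m * b + a * (a * 1) * n * (b * (b * 1))
    rearrange = solve-∀

  indexSize-O : indexSize (pllIndex G order) ≤ 94 * (w′ * n * lg)
  indexSize-O = begin
    indexSize (pllIndex G order) ≤⟨ indexSize≤ ⟩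
    n * D                        ≤⟨ *-monoʳ-≤ n D≤4E ⟩
    n * (4 * E)                  ≡⟨ rearrange w′ lg n ⟩
    4 * (w′ * n * lg)            ≤⟨ *-monoˡ-≤ (w′ * n * lg) (m≤m+n 4 90) ⟩
    94 * (w′ * n * lg)           ∎
    where
    open ≤-Reasoning
    rearrange : ∀ a b n → n * (4 * (a * b)) ≡ 4 * (a * n * b)
    rearrange = solve-∀

  answerTime-O : ∀ s t → answerTime order (pllIndex G order) s t ≤ 94 * E
  answerTime-O s t = begin
    answerTime order (pllIndex G order) s t ≤⟨ answerTime≤ s t ⟩
    1 + (D + D)                             ≤⟨ +-mono-≤ 1≤E (+-mono-≤ D≤4E D≤4E) ⟩
    E + (4 * E + 4 * E)                     ≡⟨ rearrange E ⟩
    9 * E                                   ≤⟨ *-monoˡ-≤ E (m≤m+n 9 85) ⟩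
    94 * E                                  ∎
    where
    open ≤-Reasoning
    rearrange : ∀ x → x + (4 * x + 4 * x) ≡ 9 * x
    rearrange = solve-∀

theorem4p4 :
  ∃ λ (C : ℕ) →
    ∀ {n} (G : Graph n) (w : ℕ) → IsTreeWidth G w →
    let m  = ∣E∣ G
        w′ = 1 ⊔ w
        lg = 1 ⊔ ⌊log₂ n ⌋
    in
    ∃ λ (σ : Permutation′ n) →
      let L = pllIndex G σ in
      preprocessTime G σ ≤ C * (w′ * m * lg + w′ ^ 2 * n * lg ^ 2)
      × indexSize L ≤ C * (w′ * n * lg)
      × (∀ (s t : Fin n) →
           answer σ L s t ≡ query s t L
           × answerTime σ L s t ≤ C * (w′ * lg))
theorem4p4 = 94 , λ { G w ((T , refl) , _) →
  let open Bounds G T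
  in order , preprocessTime-O , indexSize-O , λ s t → answer≡query s t , answerTime-O s t }
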